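{- Let $G$ be a graph with $\alpha(G)=2$ and $\mathrm{icr}(G)\ge \frac14+\frac{1}{62}$. Then every inflation $G'$ of $G$ with $\alpha(G')=2$ satisfies $\mathrm{had}(G')\ge\chi(G')$.
   Context: All graphs are finite and simple. An inflation of a graph $H$ is obtained by choosing integers $c_x\ge 0$ for $x\in V(H)$, replacing each $x$ by a clique $C_x$ of order $c_x$, and making every vertex of $C_x$ adjacent to every vertex of $C_y$ (for $x\ne y$) if $xy\in E(H)$, and no edges between $C_x$ and $C_y$ otherwise. The inflated clique ratio of a non-empty graph $G$ is $\mathrm{icr}(G)=\inf\{\omega(G')/|V(G')| : G' \text{ an inflation of } G \text{ with } |V(G')|>0\}$. $\mathrm{had}(G)$ is the largest $t$ such that $K_t$ is a minor of $G$. -}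

module Defs where

open import Data.Nat using (ℕ; _≤_)
open import Data.Fin using (Fin)
open import Data.Maybe using (Maybe; just)
open import Data.Product using (Σ; ∃; _×_; _,_)
open import Data.Sum using (_⊎_)
open import Relation.Nullary using (¬_; Dec)
open import Relation.Binary.PropositionalEquality using (_≡_; _≢_)
open import Function.Definitions using (Injective)
open import Level using (0ℓ)

record Graph (n : ℕ) : Set₁ where
  field
    Adj    : Fin n → Fin n → Set
    sym    : ∀ {u v} → Adj u v → Adj v u
    irrefl : ∀ {u} → ¬ Adj u u
    dec    : ∀ u v → Dec (Adj u v)
open Graph public

-- H (on Fin m) is an inflation of G (on Fin n): every vertex u of H belongs
-- to the clique C_{f u}; distinct vertices u,v of H are adjacent iff they lie
-- in the same clique or in cliques C_x, C_y with xy ∈ E(G).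
-- (c_x = |f⁻¹(x)|, possibly 0.)
IsInflationOf : ∀ {m n} → Graph m → Graph n → Set
IsInflationOf {m} {n} H G =
  Σ (Fin m → Fin n) λ f → ∀ u v → u ≢ v →
    (Adj H u v → (f u ≡ f v ⊎ Adj G (f u) (f v))) ×
    ((f u ≡ f v ⊎ Adj G (f u) (f v)) → Adj H u v)

IsClique : ∀ {n k} → Graph n → (Fin k → Fin n) → Set
IsClique G s = Injective _≡_ _≡_ s × (∀ i j → i ≢ j → Adj G (s i) (s j))

IsIndependent : ∀ {n k} → Graph n → (Fin k → Fin n) → Set
IsIndependent G s = Injective _≡_ _≡_ s × (∀ i j → ¬ Adj G (s i) (s j))

HasClique : ∀ {n} → Graph n → ℕ → Set
HasClique {n} G k = Σ (Fin k → Fin n) λ s → IsClique G s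

HasIndependentSet : ∀ {n} → Graph n → ℕ → Set
HasIndependentSet {n} G k = Σ (Fin k → Fin n) λ s → IsIndependent G s

IsCliqueNumber : ∀ {n} → Graph n → ℕ → Set
IsCliqueNumber G w = HasClique G w × (∀ k → HasClique G k → k ≤ w)

IsIndependenceNumber : ∀ {n} → Graph n → ℕ → Set
IsIndependenceNumber G a = HasIndependentSet G a × (∀ k → HasIndependentSet G k → k ≤ a)

Colourable : ∀ {n} → Graph n → ℕ → Set
Colourable {n} G k = Σ (Fin n → Fin k) λ c → ∀ u v → Adj G u v → c u ≢ c v

IsChromaticNumber : ∀ {n} → Graph n → ℕ → Set
IsChromaticNumber G k = Colourable G k × (∀ j → Colourable G j → k ≤ j)

data WalkIn {n} (G : Graph n) (P : Fin n → Set) : Fin n → Fin n → Set where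
  here : ∀ {u} → P u → WalkIn G P u u
  step : ∀ {u v w} → P u → Adj G u v → WalkIn G P v w → WalkIn G P u w

-- K_t minor: branch sets B_i = β⁻¹(just i) (pairwise disjoint automatically),
-- each non-empty and connected, and pairwise joined by an edge.
HasCliqueMinor : ∀ {n} → Graph n → ℕ → Set
HasCliqueMinor {n} G t =
  Σ (Fin n → Maybe (Fin t)) λ β →
    (∀ i → ∃ λ u → β u ≡ just i) ×
    (∀ i u v → β u ≡ just i → β v ≡ just i → WalkIn G (λ x → β x ≡ just i) u v) ×
    (∀ i j → i ≢ j → Σ (Fin n) λ u → Σ (Fin n) λ v →
        β u ≡ just i × β v ≡ just j × Adj G u v)

IsHadwigerNumber : ∀ {n} → Graph n → ℕ → Set
IsHadwigerNumber G h = HasCliqueMinor G h × (∀ t → HasCliqueMinor G t → t ≤ h)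

{-# OPTIONS --safe #-}
module Submission where

-- We work in the complement of G′, a triangle-free graph with edge relation E. Vertex sets are lists up to
-- permutation; a repeated vertex stands for twins, so every list is an inflation of G and has an independent set K
-- (a clique of the graph) with 33 |X| ≤ 124 |K|. A seagull, an induced path on three vertices, is an E-edge ab with
-- a vertex c adjacent to neither end. As every other vertex is adjacent in the graph to one of a, b, disjoint
-- seagulls outside a clique are branch sets of a complete minor together with its vertices.
--
-- Gallai's lemma reduces had ≥ χ to the case |X| = 2ν + 1 where every vertex is missed by a matching of size ν.
-- For a maximum independent set K it remains to pack k = ν + 1 - |K| seagulls in Y = X \ K, where Y has a matching
-- of size k. Since K is maximum, every independent A ⊆ Y has at least |A| neighbours in K, and if A and B are
-- completely joined these neighbourhoods are disjoint, so |A| + |B| ≤ |K|. This bound makes local exchanges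
-- sufficient: the vertices left over by a packing with an unused edge form a completely joined pair (A, B), few
-- vertices are joined to all of A or all of B, hence some seagull of the packing has two "mixed" vertices. It can
-- be replaced by two seagulls unless it is a pendant (which enlarges A) or forms a five-wheel with three vertices
-- of A and B. A five-wheel together with one more seagull contains three disjoint seagulls, and a five-wheel
-- alone is excluded by counting its neighbours in K.

open import Defs
open import Data.Empty using (⊥; ⊥-elim)
open import Data.Fin using (Fin)
import Data.Fin as Fin
open import Data.Fin.Patterns
open import Data.Fin.Properties using () renaming (_≟_ to _≟ᶠ_)
open import Data.List using (List; []; _∷_; _++_; length; concat; filter; map; lookup; tabulate; allFin)
open import Data.List.Membership.Propositional using (_∈_; lose; find)
open import Data.List.Membership.Propositional.Properties
  using (∈-∃++; ∈-++⁻; ∈-++⁺ˡ; ∈-++⁺ʳ; ∈-concat⁻′; ∈-concat⁺′; ∈-filter⁻; ∈-map⁺; ∈-map⁻; ∈-lookup; ∈-allFin; ∈-tabulate⁻)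
open import Data.List.Properties
  using (length-++; concat-++; filter-++; filter-all; length-filter; length-map; length-tabulate; map-tabulate;
         tabulate-lookup; ∷-injective; map-++)
open import Data.List.Relation.Binary.Permutation.Propositional
open import Data.List.Relation.Binary.Permutation.Propositional.Properties
import Data.List.Relation.Binary.Permutation.Setoid.Properties as SetoidPermutation
open import Data.List.Relation.Unary.All using (All; []; _∷_)
import Data.List.Relation.Unary.All as All
import Data.List.Relation.Unary.All.Properties as All
open import Data.List.Relation.Unary.AllPairs using ([]; _∷_)
open import Data.List.Relation.Unary.Any using (Any; here; there; any?)
import Data.List.Relation.Unary.Any as Any
import Data.List.Relation.Unary.Any.Properties as Any
open import Data.List.Relation.Unary.Unique.Propositional using (Unique)
open import Data.List.Relation.Unary.Unique.Propositional.Properties using (allFin⁺; tabulate⁺)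
open import Data.Maybe using (Maybe; just; nothing)
open import Data.Nat using (ℕ; zero; suc; _+_; _*_; _∸_; _≤_; _<_; z≤n; s≤s; s≤s⁻¹)
open import Data.Nat.Properties hiding (_≟_)
open import Data.Nat.Tactic.RingSolver using (solve-∀)
open import Data.Product using (Σ; ∃; ∃₂; _×_; _,_; proj₁; proj₂)
open import Data.Sum using (_⊎_; inj₁; inj₂)
import Data.Sum as Sum
open import Data.Vec using (Vec; []; _∷_)
import Data.Vec as Vec
open import Relation.Nullary using (¬_; Dec; yes; no)
open import Relation.Nullary.Decidable using (True; toWitness; ¬?; _×-dec_; decidable-stable)
open import Relation.Binary.PropositionalEquality using (_≡_; _≢_; cong; cong₂; subst)
import Relation.Binary.PropositionalEquality as ≡
open import Relation.Unary using (Decidable)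
import Algebra.Properties.CommutativeSemigroup as CommutativeSemigroup
import Algebra.Solver.CommutativeMonoid
import Algebra.Solver.CommutativeMonoid.Normal as NormalForms

pattern [_] x = x ∷ []

-- Packings of disjoint edges and seagulls.

module Packing-seagulls {V : Set} (E : V → V → Set) (E? : ∀ u v → Dec (E u v))
  (E-sym : ∀ {u v} → E u v → E v u)
  (E-tri : ∀ {a b c} → E a b → E b c → E a c → ⊥) where

  open Algebra.Solver.CommutativeMonoid (++-commutativeMonoid {A = V}) using (solve; _⊕_; _⊜_) public

  concat-↭ : ∀ {bs cs : List (List V)} → bs ↭ cs → concat bs ↭ concat cs
  concat-↭ refl = refl
  concat-↭ (prep x p) = ++⁺ˡ x (concat-↭ p)
  concat-↭ (swap x y p) = trans (shifts x y) (++⁺ˡ y (++⁺ˡ x (concat-↭ p)))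
  concat-↭ (trans p q) = trans (concat-↭ p) (concat-↭ q)

  data Edge : List V → Set where
    edge : ∀ {a b} → E a b → Edge (a ∷ b ∷ [])

  data Seagull : List V → Set where
    seagull : ∀ {a b c} → E a b → ¬ E a c → ¬ E b c → Seagull (a ∷ b ∷ c ∷ [])

  -- With `cover` stated up to permutation, blocks are disjoint copy by copy, also when a vertex is
  -- repeated. For `Edge` this is a matching.
  record Packing (Block : List V → Set) (t : ℕ) (xs : List V) : Set where
    constructor packing
    field
      {blocks} : List (List V)
      {rest}   : List V
      count    : length blocks ≡ t
      valid    : All Block blocks
      cover    : concat blocks ++ rest ↭ xs

  module _ {Block : List V → Set} where

    packing-resp : ∀ {t xs ys} → xs ↭ ys → Packing Block t xs → Packing Block t ys
    packing-resp p (packing n v c) = packing n v (trans c p)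

    packing-count : ∀ {s t xs} → s ≡ t → Packing Block s xs → Packing Block t xs
    packing-count ≡.refl P = P

    packing-zero : ∀ {xs} → Packing Block 0 xs
    packing-zero = packing {blocks = []} ≡.refl [] refl

    packing-∷ : ∀ {b t xs} → Block b → Packing Block t xs → Packing Block (suc t) (b ++ xs)
    packing-∷ {b} v (packing {bs} {r} n vs c) =
      packing (cong suc n) (v ∷ vs) (trans (++-assoc b (concat bs) r) (++⁺ˡ b c))

    packing-++ : ∀ {s t xs ys} → Packing Block s xs → Packing Block t ys →
                 Packing Block (s + t) (xs ++ ys)
    packing-++ (packing {bs} {r} n v c) (packing {bs′} {r′} n′ v′ c′) =
      packing (≡.trans (length-++ bs) (cong₂ _+_ n n′)) (All.++⁺ v v′)
        (trans (trans (↭-reflexive (cong (_++ (r ++ r′)) (≡.sym (concat-++ bs bs′))))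
          (solve 4 (λ b b′ r r′ → (b ⊕ b′) ⊕ (r ⊕ r′) ⊜ (b ⊕ r) ⊕ (b′ ⊕ r′)) refl
            (concat bs) (concat bs′) r r′)) (++⁺ c c′))

    packing-+ˡ : ∀ {t} xs {ys} → Packing Block t ys → Packing Block t (xs ++ ys)
    packing-+ˡ xs = packing-++ (packing-zero {xs})

    packing-concat : ∀ {bs} → All Block bs → Packing Block (length bs) (concat bs)
    packing-concat v = packing ≡.refl v (++-identityʳ _)

  -- Rearranging concatenations by computed normal forms.

  open Algebra.Solver.CommutativeMonoid (++-commutativeMonoid {A = V})
    using (Expr; var; id; ⟦_⟧; normalise; ⟦_⟧⇓)
    renaming (_≟_ to _≟ⁿ_)
  private
    module Normal = NormalForms (++-commutativeMonoid {A = V})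

  -- A singleton word must not end in ++ [], so that words of list variables compute to right-nested concatenations.
  word : ∀ {n} → List (Fin n) → Expr n
  word []           = id
  word [ i ]        = var i
  word (i ∷ j ∷ is) = var i ⊕ word (j ∷ is)

  -- `π` gives the order on the source side by positions in `ρ`. Normal forms in a commutative
  -- monoid are compared by evaluation, so for a concrete permutation the implicit argument is
  -- solved automatically.
  reorder : ∀ {n} (ρ : Vec (List V) n) (π : List (Fin n)) →
            {True (normalise (word π) ≟ⁿ normalise (word (Vec.toList (Vec.allFin n))))} →
            ⟦ word π ⟧ ρ ↭ ⟦ word (Vec.toList (Vec.allFin n)) ⟧ ρ
  reorder {n} ρ π {same} = trans (↭-sym (Normal.correct (word π) ρ))
    (trans (↭-reflexive (cong (λ v → ⟦ v ⟧⇓ ρ) (toWitness same)))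
      (Normal.correct (word (Vec.toList (Vec.allFin n))) ρ))

  arrange : ∀ {n} (vs : Vec V n) (π : List (Fin n)) →
            {True (normalise (word π) ≟ⁿ normalise (word (Vec.toList (Vec.allFin n))))} →
            ⟦ word π ⟧ (Vec.map [_] vs) ↭ ⟦ word (Vec.toList (Vec.allFin n)) ⟧ (Vec.map [_] vs)
  arrange vs π {same} = reorder (Vec.map [_] vs) π {same}

  non-edge : ∀ {u v} → ¬ E u v → ¬ E v u
  non-edge ¬e e = ¬e (E-sym e)

  apart : ∀ {a b c} → E a c → E b c → ¬ E a b
  apart ac bc ab = E-tri ab bc ac

  two : ∀ {p q r s t u xs} → Seagull (p ∷ q ∷ r ∷ []) → Seagull (s ∷ t ∷ u ∷ []) →
        p ∷ q ∷ r ∷ s ∷ t ∷ u ∷ [] ↭ xs → Packing Seagull 2 xs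
  two v w p = packing ≡.refl (v ∷ w ∷ []) p

  three : ∀ {p q r s t u h k l xs} → Seagull (p ∷ q ∷ r ∷ []) → Seagull (s ∷ t ∷ u ∷ []) →
          Seagull (h ∷ k ∷ l ∷ []) → p ∷ q ∷ r ∷ s ∷ t ∷ u ∷ h ∷ k ∷ l ∷ [] ↭ xs → Packing Seagull 3 xs
  three v w z p = packing ≡.refl (v ∷ w ∷ z ∷ []) p

  -- Exchanges between a path `a b a′` and a seagull `x y c`.

  Avoids : V → V → V → V → Set
  Avoids a b a′ v = ¬ E v a × ¬ E v b × ¬ E v a′

  -- When `ab` and `a′b` are edges, this says that `v` completes one of them to a seagull.
  Mixed : V → V → V → V → Set
  Mixed a b a′ v = ¬ E v b × (¬ E v a ⊎ ¬ E v a′)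

  -- Besides two seagulls on the six vertices there are two obstructions: `c` is a third leaf at `b`
  -- and `xy` is a separate edge, or the five other vertices form a pentagon with hub `c`. `wheel′`
  -- is `wheel` with `x` and `y` exchanged.
  data Local (a b a′ x y c : V) : Set where
    tiled   : Packing Seagull 2 (a ∷ b ∷ a′ ∷ x ∷ y ∷ c ∷ []) → Local a b a′ x y c
    pendant : Avoids a b a′ x → Avoids a b a′ y → E c b → Local a b a′ x y c
    wheel   : E x a′ → E y a → Avoids a b a′ c → Local a b a′ x y c
    wheel′  : E x a → E y a′ → Avoids a b a′ c → Local a b a′ x y c

  module _ {a b a′ x y c : V} where

    swapˡ : Local a′ b a x y c → Local a b a′ x y c
    swapˡ (tiled p) = tiled (packing-resp (arrange (a ∷ b ∷ a′ ∷ x ∷ y ∷ c ∷ []) (2F ∷ 1F ∷ 0F ∷ 3F ∷ 4F ∷ 5F ∷ [])) p)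
    swapˡ (pendant (p , q , r) (p′ , q′ , r′) cb) = pendant (r , q , p) (r′ , q′ , p′) cb
    swapˡ (wheel xa ya′ (p , q , r)) = wheel′ xa ya′ (r , q , p)
    swapˡ (wheel′ xa′ ya (p , q , r)) = wheel xa′ ya (r , q , p)

    swapʳ : Local a b a′ y x c → Local a b a′ x y c
    swapʳ (tiled p) = tiled (packing-resp (arrange (a ∷ b ∷ a′ ∷ x ∷ y ∷ c ∷ []) (0F ∷ 1F ∷ 2F ∷ 4F ∷ 3F ∷ 5F ∷ [])) p)
    swapʳ (pendant p q cb) = pendant q p cb
    swapʳ (wheel ya′ xa p) = wheel′ xa ya′ p
    swapʳ (wheel′ ya xa′ p) = wheel xa′ ya p

  mixed-swap : ∀ {a b a′ v} → Mixed a b a′ v → Mixed a′ b a v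
  mixed-swap (p , inj₁ q) = p , inj₂ q
  mixed-swap (p , inj₂ q) = p , inj₁ q

  module _ {a b a′ x y c : V} (ab : E a b) (a′b : E a′ b) (xy : E x y) (¬xc : ¬ E x c) (¬yc : ¬ E y c) where

    private
      ¬aa′ : ¬ E a a′
      ¬aa′ = apart ab a′b
      tile : ∀ {p q r s t u} → Seagull (p ∷ q ∷ r ∷ []) → Seagull (s ∷ t ∷ u ∷ []) →
             p ∷ q ∷ r ∷ s ∷ t ∷ u ∷ [] ↭ a ∷ b ∷ a′ ∷ x ∷ y ∷ c ∷ [] → Local a b a′ x y c
      tile v w π = tiled (two v w π)
      vs : Vec V 6
      vs = a ∷ b ∷ a′ ∷ x ∷ y ∷ c ∷ []

    -- A leaf adjacent to `c` forms a seagull with `c` and `x`, and the other leaf one with `b` and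
    -- `y`. If `c` misses the whole path, `xy` takes a leaf and the remaining edge takes `c`. The
    -- case left over, a star with three leaves beside an edge, has no tiling.
    both-avoid : Avoids a b a′ x → Avoids a b a′ y → Local a b a′ x y c
    both-avoid (¬xa , ¬xb , ¬xa′) (¬ya , ¬yb , ¬ya′) with E? c a | E? c a′ | E? c b
    ... | yes ca | _ | _ = tile (seagull ca (non-edge ¬xc) (non-edge ¬xa)) (seagull (E-sym a′b) (non-edge ¬yb) (non-edge ¬ya′))
                             (arrange vs (5F ∷ 0F ∷ 3F ∷ 1F ∷ 2F ∷ 4F ∷ []))
    ... | no _ | yes ca′ | _ = tile (seagull ca′ (non-edge ¬xc) (non-edge ¬xa′)) (seagull (E-sym ab) (non-edge ¬yb) (non-edge ¬ya))
                             (arrange vs (5F ∷ 2F ∷ 3F ∷ 1F ∷ 0F ∷ 4F ∷ []))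
    ... | no _ | no _ | yes cb = pendant (¬xa , ¬xb , ¬xa′) (¬ya , ¬yb , ¬ya′) cb
    ... | no ¬ca | no _ | no ¬cb = tile (seagull xy ¬xa′ ¬ya′) (seagull ab (non-edge ¬ca) (non-edge ¬cb))
                             (arrange vs (3F ∷ 4F ∷ 2F ∷ 0F ∷ 1F ∷ 5F ∷ []))

    one-avoids : Avoids a b a′ x → E y a → ¬ E y b → ¬ E y a′ → Local a b a′ x y c
    one-avoids (¬xa , ¬xb , ¬xa′) ya ¬yb ¬ya′ with E? c a
    ... | yes ca = tile (seagull ca (non-edge ¬xc) (non-edge ¬xa)) (seagull (E-sym a′b) (non-edge ¬yb) (non-edge ¬ya′))
                     (arrange vs (5F ∷ 0F ∷ 3F ∷ 1F ∷ 2F ∷ 4F ∷ []))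
    ... | no ¬ca = tile (seagull a′b (non-edge ¬xa′) (non-edge ¬xb)) (seagull ya ¬yc (non-edge ¬ca))
                     (arrange vs (2F ∷ 1F ∷ 3F ∷ 4F ∷ 0F ∷ 5F ∷ []))

    -- `c` misses `x` and `y`, so it is either the hub of the pentagon `a b a′ x y` or adjacent to
    -- one of `a`, `b`, `a′`; each such adjacency yields a tiling.
    pentagon : E x a′ → E y a → ¬ E x b → ¬ E y b → Local a b a′ x y c
    pentagon xa′ ya ¬xb ¬yb with E? c b | E? c a | E? c a′
    ... | yes cb | _ | _ = tile (seagull (E-sym cb) (non-edge ¬xb) (non-edge ¬xc)) (seagull ya (apart (E-sym xy) (E-sym xa′)) ¬aa′)
                             (arrange vs (1F ∷ 5F ∷ 3F ∷ 4F ∷ 0F ∷ 2F ∷ []))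
    ... | no _ | yes ca | _ = tile (seagull ca (non-edge ¬xc) (apart (E-sym ya) xy))
                           (seagull (E-sym a′b) (non-edge ¬yb) (apart (E-sym xa′) (E-sym xy)))
                             (arrange vs (5F ∷ 0F ∷ 3F ∷ 1F ∷ 2F ∷ 4F ∷ []))
    ... | no _ | no _ | yes ca′ = tile (seagull ca′ (non-edge ¬yc) (apart (E-sym xa′) (E-sym xy)))
                           (seagull (E-sym ab) (non-edge ¬xb) (apart (E-sym ya) xy))
                             (arrange vs (5F ∷ 2F ∷ 4F ∷ 1F ∷ 0F ∷ 3F ∷ []))
    ... | no ¬cb | no ¬ca | no ¬ca′ = wheel xa′ ya (¬ca , ¬cb , ¬ca′)

  mixed-avoids : ∀ {a b a′ v} → Mixed a b a′ v → E v a → ¬ E v a′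
  mixed-avoids (_ , inj₁ ¬va) va = ⊥-elim (¬va va)
  mixed-avoids (_ , inj₂ ¬va′) _ = ¬va′

  module _ {a b a′ x y c : V} (ab : E a b) (a′b : E a′ b) (xy : E x y) (¬xc : ¬ E x c) (¬yc : ¬ E y c) where

    -- Each of `x`, `y` is adjacent to at most one leaf, and they share none because `xy` is an
    -- edge. Up to exchanging the leaves and exchanging `x` and `y`, three configurations remain.
    local-xy : Mixed a b a′ x → Mixed a b a′ y → Local a b a′ x y c
    local-xy mx@(¬xb , _) my@(¬yb , _) with E? x a | E? x a′ | E? y a | E? y a′
    ... | no ¬xa | no ¬xa′ | no ¬ya | no ¬ya′ =
      both-avoid ab a′b xy ¬xc ¬yc (¬xa , ¬xb , ¬xa′) (¬ya , ¬yb , ¬ya′)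
    ... | no ¬xa | no ¬xa′ | yes ya | _ =
      one-avoids ab a′b xy ¬xc ¬yc (¬xa , ¬xb , ¬xa′) ya ¬yb (mixed-avoids my ya)
    ... | no ¬xa | no ¬xa′ | no ¬ya | yes ya′ =
      swapˡ (one-avoids a′b ab xy ¬xc ¬yc (¬xa′ , ¬xb , ¬xa) ya′ ¬yb ¬ya)
    ... | yes xa | _ | _ | yes ya′ = swapˡ (pentagon a′b ab xy ¬xc ¬yc xa ya′ ¬xb ¬yb)
    ... | yes xa | _ | _ | no ¬ya′ =
      swapʳ (one-avoids ab a′b (E-sym xy) ¬yc ¬xc
        (apart (E-sym xy) (E-sym xa) , ¬yb , ¬ya′) xa ¬xb (mixed-avoids mx xa))
    ... | no _ | yes xa′ | yes ya | _ = pentagon ab a′b xy ¬xc ¬yc xa′ ya ¬xb ¬yb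
    ... | no ¬xa | yes xa′ | no ¬ya | _ =
      swapʳ (swapˡ (one-avoids a′b ab (E-sym xy) ¬yc ¬xc
        (apart (E-sym xy) (E-sym xa′) , ¬yb , ¬ya) xa′ ¬xb ¬xa))

    private
      vs : Vec V 6
      vs = a ∷ b ∷ a′ ∷ x ∷ y ∷ c ∷ []
      tile : ∀ {p q r s t u} → Seagull (p ∷ q ∷ r ∷ []) → Seagull (s ∷ t ∷ u ∷ []) →
             p ∷ q ∷ r ∷ s ∷ t ∷ u ∷ [] ↭ a ∷ b ∷ a′ ∷ x ∷ y ∷ c ∷ [] → Local a b a′ x y c
      tile v w π = tiled (two v w π)

    -- Here y is adjacent to the centre b or to both leaves, otherwise local-xy applies.
    local-xc : Mixed a b a′ x → Mixed a b a′ c → Local a b a′ x y c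
    local-xc mx@(¬xb , xm) mc@(¬cb , cm) with E? y b | E? y a | E? y a′
    ... | no ¬yb | no ¬ya | _ = local-xy mx (¬yb , inj₁ ¬ya)
    ... | no ¬yb | yes _ | no ¬ya′ = local-xy mx (¬yb , inj₂ ¬ya′)
    ... | no ¬yb | yes ya | yes ya′ = by-c (E? c a) (E? c a′)
      where
      by-c : Dec (E c a) → Dec (E c a′) → Local a b a′ x y c
      by-c (yes ca) _ = tile (seagull xy ¬xb ¬yb) (seagull ca (mixed-avoids mc ca) (apart ab a′b))
                          (arrange vs (3F ∷ 4F ∷ 1F ∷ 5F ∷ 0F ∷ 2F ∷ []))
      by-c (no _) (yes ca′) = tile (seagull xy ¬xb ¬yb) (seagull ca′ (mixed-avoids (mixed-swap mc) ca′) (apart a′b ab))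
                          (arrange vs (3F ∷ 4F ∷ 1F ∷ 5F ∷ 2F ∷ 0F ∷ []))
      by-c (no ¬ca) (no _) = tile (seagull ya ¬yc (non-edge ¬ca)) (seagull (E-sym a′b) (non-edge ¬xb) (apart (E-sym ya′) xy))
                          (arrange vs (4F ∷ 0F ∷ 5F ∷ 1F ∷ 2F ∷ 3F ∷ []))
    ... | yes yb | _ | _ = by-x (E? x a) (E? x a′) cm
      where
      ¬ya : ¬ E y a
      ¬ya = apart yb ab
      ¬ya′ : ¬ E y a′
      ¬ya′ = apart yb a′b
      by-x : Dec (E x a) → Dec (E x a′) → (¬ E c a ⊎ ¬ E c a′) → Local a b a′ x y c
      by-x (yes xa) _ _ = tile (seagull xa (mixed-avoids mx xa) (apart ab a′b)) (seagull yb ¬yc (non-edge ¬cb))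
                            (arrange vs (3F ∷ 0F ∷ 2F ∷ 4F ∷ 1F ∷ 5F ∷ []))
      by-x (no _) (yes xa′) _ = tile (seagull xa′ (mixed-avoids (mixed-swap mx) xa′) (apart a′b ab)) (seagull yb ¬yc (non-edge ¬cb))
                            (arrange vs (3F ∷ 2F ∷ 0F ∷ 4F ∷ 1F ∷ 5F ∷ []))
      by-x (no _) (no ¬xa′) (inj₁ ¬ca) = tile (seagull xy ¬xa′ ¬ya′) (seagull (E-sym ab) (non-edge ¬cb) (non-edge ¬ca))
                            (arrange vs (3F ∷ 4F ∷ 2F ∷ 1F ∷ 0F ∷ 5F ∷ []))
      by-x (no ¬xa) (no _) (inj₂ ¬ca′) = tile (seagull xy ¬xa ¬ya) (seagull (E-sym a′b) (non-edge ¬cb) (non-edge ¬ca′))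
                            (arrange vs (3F ∷ 4F ∷ 0F ∷ 1F ∷ 2F ∷ 5F ∷ []))

  data TwoOf (P : V → Set) (x y c : V) : Set where
    first-second : P x → P y → TwoOf P x y c
    first-third : P x → P c → TwoOf P x y c
    second-third : P y → P c → TwoOf P x y c

  local : ∀ {a b a′ x y c} → E a b → E a′ b → Seagull (x ∷ y ∷ c ∷ []) →
          TwoOf (Mixed a b a′) x y c → Local a b a′ x y c
  local ab a′b (seagull xy ¬xc ¬yc) (first-second mx my) = local-xy ab a′b xy ¬xc ¬yc mx my
  local ab a′b (seagull xy ¬xc ¬yc) (first-third mx mc) = local-xc ab a′b xy ¬xc ¬yc mx mc
  local ab a′b (seagull xy ¬xc ¬yc) (second-third my mc) = swapʳ (local-xc ab a′b (E-sym xy) ¬yc ¬xc my mc)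

  -- Three seagulls in a five-wheel and a further seagull.

  -- A five-wheel with hub h in the graph itself, since the complement of a pentagon is a pentagon.
  record Wheel (v₀ v₁ v₂ v₃ v₄ h : V) : Set where
    constructor mkWheel
    field
      e₀  : E v₀ v₁
      e₁  : E v₁ v₂
      e₂  : E v₂ v₃
      e₃  : E v₃ v₄
      e₄  : E v₄ v₀
      ¬h₀ : ¬ E h v₀
      ¬h₁ : ¬ E h v₁
      ¬h₂ : ¬ E h v₂
      ¬h₃ : ¬ E h v₃
      ¬h₄ : ¬ E h v₄

  rotate : ∀ {v₀ v₁ v₂ v₃ v₄ h} → Wheel v₀ v₁ v₂ v₃ v₄ h → Wheel v₁ v₂ v₃ v₄ v₀ h
  rotate (mkWheel e₀ e₁ e₂ e₃ e₄ ¬h₀ ¬h₁ ¬h₂ ¬h₃ ¬h₄) = mkWheel e₁ e₂ e₃ e₄ e₀ ¬h₁ ¬h₂ ¬h₃ ¬h₄ ¬h₀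

  reflect : ∀ {v₀ v₁ v₂ v₃ v₄ h} → Wheel v₀ v₁ v₂ v₃ v₄ h → Wheel v₀ v₄ v₃ v₂ v₁ h
  reflect (mkWheel e₀ e₁ e₂ e₃ e₄ ¬h₀ ¬h₁ ¬h₂ ¬h₃ ¬h₄) =
    mkWheel (E-sym e₄) (E-sym e₃) (E-sym e₂) (E-sym e₁) (E-sym e₀) ¬h₀ ¬h₄ ¬h₃ ¬h₂ ¬h₁

  nine : (v₀ v₁ v₂ v₃ v₄ h x y c : V) → List V
  nine v₀ v₁ v₂ v₃ v₄ h x y c = v₀ ∷ v₁ ∷ v₂ ∷ v₃ ∷ v₄ ∷ h ∷ x ∷ y ∷ c ∷ []

  module _ {v₀ v₁ v₂ v₃ v₄ h x y c : V} where
    private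
      vs : Vec V 9
      vs = v₀ ∷ v₁ ∷ v₂ ∷ v₃ ∷ v₄ ∷ h ∷ x ∷ y ∷ c ∷ []

    nine-rotate : nine v₁ v₂ v₃ v₄ v₀ h x y c ↭ nine v₀ v₁ v₂ v₃ v₄ h x y c
    nine-rotate = arrange vs (1F ∷ 2F ∷ 3F ∷ 4F ∷ 0F ∷ 5F ∷ 6F ∷ 7F ∷ 8F ∷ [])

    nine-reflect : nine v₀ v₄ v₃ v₂ v₁ h x y c ↭ nine v₀ v₁ v₂ v₃ v₄ h x y c
    nine-reflect = arrange vs (0F ∷ 4F ∷ 3F ∷ 2F ∷ 1F ∷ 5F ∷ 6F ∷ 7F ∷ 8F ∷ [])

    nine-swap : nine v₀ v₁ v₂ v₃ v₄ h y x c ↭ nine v₀ v₁ v₂ v₃ v₄ h x y c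
    nine-swap = arrange vs (0F ∷ 1F ∷ 2F ∷ 3F ∷ 4F ∷ 5F ∷ 7F ∷ 6F ∷ 8F ∷ [])

    module _ (C : Wheel v₀ v₁ v₂ v₃ v₄ h)
      (xy : E x y) (¬xc : ¬ E x c) (¬yc : ¬ E y c) where

      private
        open Wheel C
        Tiling : Set
        Tiling = Packing Seagull 3 (nine v₀ v₁ v₂ v₃ v₄ h x y c)
        ¬v₁v₄ : ¬ E v₁ v₄
        ¬v₁v₄ = apart (E-sym e₀) e₄
        ¬v₂v₄ : ¬ E v₂ v₄
        ¬v₂v₄ = apart e₂ (E-sym e₃)
        ¬v₀v₃ : ¬ E v₀ v₃
        ¬v₀v₃ = apart (E-sym e₄) e₃

      tile-avoiding : ¬ E x v₀ → ¬ E y v₀ → ¬ E c v₃ → ¬ E c v₄ → Tiling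
      tile-avoiding ¬xv₀ ¬yv₀ ¬cv₃ ¬cv₄ =
        three (seagull xy ¬xv₀ ¬yv₀) (seagull e₁ (non-edge ¬h₁) (non-edge ¬h₂)) (seagull e₃ (non-edge ¬cv₃) (non-edge ¬cv₄))
          (arrange vs (6F ∷ 7F ∷ 0F ∷ 1F ∷ 2F ∷ 5F ∷ 3F ∷ 4F ∷ 8F ∷ []))

      tile-hub : ¬ E h x → ¬ E h y → E c v₀ → ¬ E c v₃ → Tiling
      tile-hub ¬hx ¬hy cv₀ ¬cv₃ =
        three (seagull xy (non-edge ¬hx) (non-edge ¬hy)) (seagull cv₀ ¬cv₃ ¬v₀v₃) (seagull e₁ ¬v₁v₄ ¬v₂v₄)
          (arrange vs (6F ∷ 7F ∷ 5F ∷ 8F ∷ 0F ∷ 3F ∷ 1F ∷ 2F ∷ 4F ∷ []))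

      -- Here `xy` cannot take the hub, but `hx` is another edge to build on. At most one of `x`,
      -- `y` is adjacent to `v₀`, and the cases follow which one.
      tile-hx : E h x → E c v₀ → ¬ E c v₃ → Tiling
      tile-hx hx cv₀ ¬cv₃ with E? x v₀ | E? y v₀
      ... | no ¬xv₀ | no ¬yv₀ = tile-avoiding ¬xv₀ ¬yv₀ ¬cv₃ (apart cv₀ e₄)
      ... | no ¬xv₀ | yes yv₀ with E? y v₃
      ...   | yes yv₃ = three (seagull hx ¬h₀ ¬xv₀) (seagull e₁ ¬v₁v₄ ¬v₂v₄) (seagull yv₃ ¬yc (non-edge ¬cv₃))
                          (arrange vs (5F ∷ 6F ∷ 0F ∷ 1F ∷ 2F ∷ 4F ∷ 7F ∷ 3F ∷ 8F ∷ []))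
      ...   | no ¬yv₃ = three (seagull cv₀ (non-edge ¬xc) (non-edge ¬xv₀)) (seagull e₁ (non-edge ¬h₁) (non-edge ¬h₂))
                          (seagull e₃ (non-edge ¬yv₃) (apart e₄ yv₀))
                          (arrange vs (8F ∷ 0F ∷ 6F ∷ 1F ∷ 2F ∷ 5F ∷ 3F ∷ 4F ∷ 7F ∷ []))
      tile-hx hx cv₀ ¬cv₃ | yes xv₀ | _ with E? x v₂
      ...   | yes xv₂ = three (seagull cv₀ (non-edge ¬yc) (apart (E-sym xv₀) (E-sym xy))) (seagull e₁ ¬v₁v₄ ¬v₂v₄)
                          (seagull hx ¬h₃ (apart xv₂ (E-sym e₂)))
                          (arrange vs (8F ∷ 0F ∷ 7F ∷ 1F ∷ 2F ∷ 4F ∷ 5F ∷ 6F ∷ 3F ∷ []))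
      ...   | no ¬xv₂ = three (seagull cv₀ (non-edge ¬yc) (apart (E-sym xv₀) (E-sym xy)))
                          (seagull e₁ (apart (E-sym e₀) xv₀) (non-edge ¬xv₂))
                          (seagull e₃ (non-edge ¬h₃) (non-edge ¬h₄))
                          (arrange vs (8F ∷ 0F ∷ 7F ∷ 1F ∷ 2F ∷ 6F ∷ 3F ∷ 4F ∷ 5F ∷ []))

  tile-attached : ∀ {v₀ v₁ v₂ v₃ v₄ h x y c} → Wheel v₀ v₁ v₂ v₃ v₄ h →
    E x y → ¬ E x c → ¬ E y c →
    E c v₀ → ¬ E c v₃ → Packing Seagull 3 (nine v₀ v₁ v₂ v₃ v₄ h x y c)
  tile-attached {h = h} {x} {y} C xy ¬xc ¬yc cv₀ ¬cv₃ with E? h x | E? h y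
  ... | yes hx | _ = tile-hx C xy ¬xc ¬yc hx cv₀ ¬cv₃
  ... | no _ | yes hy = packing-resp nine-swap (tile-hx C (E-sym xy) ¬yc ¬xc hy cv₀ ¬cv₃)
  ... | no ¬hx | no ¬hy = tile-hub C xy ¬xc ¬yc ¬hx ¬hy cv₀ ¬cv₃

  -- `c` cannot be adjacent to both ends of `v₂v₃`, and reflecting the wheel in `v₀` exchanges these
  -- two vertices.
  tile-adjacent : ∀ {v₀ v₁ v₂ v₃ v₄ h x y c} → Wheel v₀ v₁ v₂ v₃ v₄ h →
    E x y → ¬ E x c → ¬ E y c →
    E c v₀ → Packing Seagull 3 (nine v₀ v₁ v₂ v₃ v₄ h x y c)
  tile-adjacent {v₃ = v₃} {c = c} C xy ¬xc ¬yc cv₀ with E? c v₃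
  ... | no ¬cv₃ = tile-attached C xy ¬xc ¬yc cv₀ ¬cv₃
  ... | yes cv₃ = packing-resp nine-reflect
    (tile-attached (reflect C) xy ¬xc ¬yc cv₀ (apart cv₃ (Wheel.e₂ C)))

  -- If `c` is adjacent to `v₀`, `v₃` or `v₄`, a rotation brings that vertex to position 0.
  -- Otherwise `c` completes `v₃v₄`, the hub completes `v₁v₂`, and only an adjacency of `x` or `y`
  -- to `v₀` keeps `xy` from taking `v₀`.
  tile-unless-hit : ∀ {v₀ v₁ v₂ v₃ v₄ h x y c} → Wheel v₀ v₁ v₂ v₃ v₄ h →
    E x y → ¬ E x c → ¬ E y c →
    Packing Seagull 3 (nine v₀ v₁ v₂ v₃ v₄ h x y c) ⊎ (E x v₀ ⊎ E y v₀)
  tile-unless-hit {v₀} {v₁} {v₂} {v₃} {v₄} {h} {x} {y} {c} C xy ¬xc ¬yc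
    with E? c v₀ | E? c v₃ | E? c v₄ | E? x v₀ | E? y v₀
  ... | yes cv₀ | _ | _ | _ | _ = inj₁ (tile-adjacent C xy ¬xc ¬yc cv₀)
  ... | no _ | yes cv₃ | _ | _ | _ = inj₁ (packing-resp (trans nine-rotate (trans nine-rotate nine-rotate))
    (tile-adjacent (rotate (rotate (rotate C))) xy ¬xc ¬yc cv₃))
  ... | no _ | no _ | yes cv₄ | _ | _ = inj₁ (packing-resp (trans nine-rotate (trans nine-rotate (trans nine-rotate nine-rotate)))
    (tile-adjacent (rotate (rotate (rotate (rotate C)))) xy ¬xc ¬yc cv₄))
  ... | no _ | no _ | no _ | yes xv₀ | _ = inj₂ (inj₁ xv₀)
  ... | no _ | no _ | no _ | no _ | yes yv₀ = inj₂ (inj₂ yv₀)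
  ... | no _ | no ¬cv₃ | no ¬cv₄ | no ¬xv₀ | no ¬yv₀ = inj₁ (tile-avoiding C xy ¬xc ¬yc ¬xv₀ ¬yv₀ ¬cv₃ ¬cv₄)

  -- If every vertex of the pentagon were hit by x or y, then x and y would two-colour it.
  tile-nine : ∀ {v₀ v₁ v₂ v₃ v₄ h x y c} → Wheel v₀ v₁ v₂ v₃ v₄ h → Seagull (x ∷ y ∷ c ∷ []) →
              Packing Seagull 3 (nine v₀ v₁ v₂ v₃ v₄ h x y c)
  tile-nine {v₀} {v₁} {v₂} {v₃} {v₄} {h} {x} {y} {c} W (seagull xy ¬xc ¬yc) = outcome
    (at W)
    (back nine-rotate (at W₁))
    (back (trans nine-rotate nine-rotate) (at W₂))
    (back (trans nine-rotate (trans nine-rotate nine-rotate)) (at W₃))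
    (back (trans nine-rotate (trans nine-rotate (trans nine-rotate nine-rotate))) (at W₄))
    where
    open Wheel W
    W₁ = rotate W
    W₂ = rotate W₁
    W₃ = rotate W₂
    W₄ = rotate W₃

    Tiling : Set
    Tiling = Packing Seagull 3 (nine v₀ v₁ v₂ v₃ v₄ h x y c)

    Hit : V → Set
    Hit v = E x v ⊎ E y v

    at : ∀ {u₀ u₁ u₂ u₃ u₄} → Wheel u₀ u₁ u₂ u₃ u₄ h →
         Packing Seagull 3 (nine u₀ u₁ u₂ u₃ u₄ h x y c) ⊎ Hit u₀
    at W′ = tile-unless-hit W′ xy ¬xc ¬yc

    back : ∀ {xs} {P : Set} → xs ↭ nine v₀ v₁ v₂ v₃ v₄ h x y c → Packing Seagull 3 xs ⊎ P → Tiling ⊎ P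
    back π (inj₁ t) = inj₁ (packing-resp π t)
    back π (inj₂ p) = inj₂ p

    x→y : ∀ {u v} → E u v → E x u → Hit v → E y v
    x→y uv xu (inj₁ xv) = ⊥-elim (E-tri xu uv xv)
    x→y uv xu (inj₂ yv) = yv

    y→x : ∀ {u v} → E u v → E y u → Hit v → E x v
    y→x uv yu (inj₁ xv) = xv
    y→x uv yu (inj₂ yv) = ⊥-elim (E-tri yu uv yv)

    outcome : Tiling ⊎ Hit v₀ → Tiling ⊎ Hit v₁ → Tiling ⊎ Hit v₂ → Tiling ⊎ Hit v₃ → Tiling ⊎ Hit v₄ → Tiling
    outcome (inj₁ t) _ _ _ _ = t
    outcome _ (inj₁ t) _ _ _ = t
    outcome _ _ (inj₁ t) _ _ = t
    outcome _ _ _ (inj₁ t) _ = t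
    outcome _ _ _ _ (inj₁ t) = t
    outcome (inj₂ (inj₁ xv₀)) (inj₂ p₁) (inj₂ p₂) (inj₂ p₃) (inj₂ p₄) =
      ⊥-elim (E-tri (y→x e₃ (x→y e₂ (y→x e₁ (x→y e₀ xv₀ p₁) p₂) p₃) p₄) e₄ xv₀)
    outcome (inj₂ (inj₂ yv₀)) (inj₂ p₁) (inj₂ p₂) (inj₂ p₃) (inj₂ p₄) =
      ⊥-elim (E-tri (x→y e₃ (y→x e₂ (x→y e₁ (y→x e₀ yv₀ p₁) p₂) p₃) p₄) e₄ yv₀)

  -- Waiting edges and the gain from a five-wheel.

  Detached : List V → List V → Set
  Detached xs zs = ∀ {v z} → v ∈ xs → z ∈ zs → ¬ E v z

  fill : ∀ Z {F} → All Edge F → Detached (concat F) Z → length F ≤ length Z →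
         Packing Seagull (length F) (Z ++ concat F)
  fill Z [] det le = packing-zero
  fill (z ∷ Z) {(a ∷ b ∷ []) ∷ F} (edge ab ∷ fs) det (s≤s le) =
    packing-resp (reorder ([ z ] ∷ Z ∷ [ a ] ∷ [ b ] ∷ concat F ∷ []) (2F ∷ 3F ∷ 0F ∷ 1F ∷ 4F ∷ []))
      (packing-∷ (seagull ab (det (here ≡.refl) (here ≡.refl)) (det (there (here ≡.refl)) (here ≡.refl)))
        (fill Z fs (λ v z → det (there (there v)) (there z)) le))

  fill-concat : ∀ Z {F Q} → All Edge F → All Seagull Q → Detached (concat F) Z → length F ≤ length Z →
                Packing Seagull (length F + length Q) (Z ++ concat F ++ concat Q)
  fill-concat Z {F} {Q} fs ss det le =
    packing-resp (++-assoc Z (concat F) (concat Q)) (packing-++ (fill Z fs det le) (packing-concat ss))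

  private
    pattern f10 = Fin.suc 9F
    pattern f11 = Fin.suc f10

  module Augment (U : List V) (w : ℕ) where

    -- The one configuration without a gain: a bare five-wheel has six vertices but no two disjoint
    -- seagulls.
    Exceptional : Set
    Exceptional = w ≤ 3 × ∃₂ λ v₀ v₁ → ∃₂ λ v₂ v₃ → ∃₂ λ v₄ h →
      Wheel v₀ v₁ v₂ v₃ v₄ h × v₀ ∷ v₁ ∷ v₂ ∷ v₃ ∷ v₄ ∷ h ∷ [] ↭ U

    Outcome : ℕ → Set
    Outcome n = Packing Seagull n U ⊎ Exceptional

    seven : ∀ {v₀ v₁ v₂ v₃ v₄ h z} → Wheel v₀ v₁ v₂ v₃ v₄ h → E z v₁ ⊎ E z v₀ × E z v₂ →
            Packing Seagull 2 (v₀ ∷ v₁ ∷ v₂ ∷ v₃ ∷ v₄ ∷ h ∷ z ∷ [])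
    seven {v₀} {v₁} {v₂} {v₃} {v₄} {h} {z} W side = by side (E? z v₃)
      where
      open Wheel W
      vs : Vec V 7
      vs = v₀ ∷ v₁ ∷ v₂ ∷ v₃ ∷ v₄ ∷ h ∷ z ∷ []
      by : E z v₁ ⊎ E z v₀ × E z v₂ → Dec (E z v₃) → Packing Seagull 2 (v₀ ∷ v₁ ∷ v₂ ∷ v₃ ∷ v₄ ∷ h ∷ z ∷ [])
      by (inj₁ zv₁) (no ¬zv₃) = packing {rest = [ v₁ ]} ≡.refl
        (seagull e₂ (apart (E-sym e₁) zv₁) (non-edge ¬zv₃) ∷ seagull e₄ (non-edge ¬h₄) (non-edge ¬h₀) ∷ [])
        (arrange vs (2F ∷ 3F ∷ 6F ∷ 4F ∷ 0F ∷ 5F ∷ 1F ∷ []))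
      by (inj₁ zv₁) (yes zv₃) = packing {rest = [ v₁ ]} ≡.refl
        (seagull e₄ (apart (E-sym e₃) zv₃) (apart e₀ zv₁) ∷ seagull e₂ (non-edge ¬h₂) (non-edge ¬h₃) ∷ [])
        (arrange vs (4F ∷ 0F ∷ 6F ∷ 2F ∷ 3F ∷ 5F ∷ 1F ∷ []))
      by (inj₂ (zv₀ , zv₂)) _ = packing {rest = [ v₂ ]} ≡.refl
        (seagull e₃ (apart (E-sym e₂) zv₂) (apart e₄ zv₀) ∷ seagull e₀ (non-edge ¬h₀) (non-edge ¬h₁) ∷ [])
        (arrange vs (3F ∷ 4F ∷ 6F ∷ 0F ∷ 1F ∷ 5F ∷ 2F ∷ []))

    -- How a leftover vertex of a completely joined pair sees the path `a b a′`: from the side of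
    -- the leaves it is adjacent to the centre, from the side of the centre to both leaves.
    Side : V → V → V → V → Set
    Side a b a′ z = E z b ⊎ E z a × E z a′

    -- Another seagull, or a waiting edge completed by a leftover vertex, lets `tile-nine` gain one;
    -- a leftover vertex alone lets `seven` do so. By `room` a waiting edge always comes with a
    -- leftover vertex, so only the bare wheel remains.
    wheel-augment : ∀ {v₀ v₁ v₂ v₃ v₄ h Z F Q} → Wheel v₀ v₁ v₂ v₃ v₄ h →
      v₀ ∷ v₁ ∷ v₂ ∷ v₃ ∷ v₄ ∷ h ∷ Z ++ concat F ++ concat Q ↭ U →
      (∀ {z} → z ∈ Z → Side v₀ v₁ v₂ z) → All Edge F → All Seagull Q → Detached (concat F) Z →
      length F ≤ length Z → w < 4 + length Z + length Q →
      Outcome (2 + (length F + length Q))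
    wheel-augment {v₀} {v₁} {v₂} {v₃} {v₄} {h} {Z} {F} {(p ∷ q ∷ r ∷ []) ∷ Q} W cover side fs (s@(seagull _ _ _) ∷ ss) det room tight =
      inj₁ (packing-resp (trans
        (reorder ([ v₀ ] ∷ [ v₁ ] ∷ [ v₂ ] ∷ [ v₃ ] ∷ [ v₄ ] ∷ [ h ] ∷ Z ∷ concat F ∷ [ p ] ∷ [ q ] ∷ [ r ] ∷ concat Q ∷ [])
          (0F ∷ 1F ∷ 2F ∷ 3F ∷ 4F ∷ 5F ∷ 8F ∷ 9F ∷ f10 ∷ 6F ∷ 7F ∷ f11 ∷ [])) cover)
        (packing-count (cong (2 +_) (≡.sym (+-suc (length F) (length Q))))
          (packing-++ (tile-nine W s) (fill-concat Z fs ss det room))))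
    wheel-augment {Z = []} {[]} {[]} W cover side [] [] det room tight =
      -- With `Z` and `Q` empty, `tight` reads `w < 4`.
      inj₂ (s≤s⁻¹ tight , _ , _ , _ , _ , _ , _ , W , cover)
    wheel-augment {Z = z ∷ Z} {[]} {[]} W cover side [] [] det room tight =
      inj₁ (packing-resp cover (packing-++ (seven W (side (here ≡.refl))) (packing-zero {xs = Z ++ []})))
    wheel-augment {v₀} {v₁} {v₂} {v₃} {v₄} {h} {z ∷ Z} {(a ∷ b ∷ []) ∷ F} {[]} W cover side (edge ab ∷ fs) [] det room tight =
      inj₁ (packing-resp (trans
        (reorder ([ v₀ ] ∷ [ v₁ ] ∷ [ v₂ ] ∷ [ v₃ ] ∷ [ v₄ ] ∷ [ h ] ∷ [ z ] ∷ Z ∷ [ a ] ∷ [ b ] ∷ (concat F ++ []) ∷ [])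
          (0F ∷ 1F ∷ 2F ∷ 3F ∷ 4F ∷ 5F ∷ 8F ∷ 9F ∷ 6F ∷ 7F ∷ f10 ∷ [])) cover)
        (packing-++ (tile-nine W (seagull ab (det (here ≡.refl) (here ≡.refl)) (det (there (here ≡.refl)) (here ≡.refl))))
          (fill-concat Z fs [] (λ v z → det (there (there v)) (there z)) (s≤s⁻¹ room))))

  -- Completely joined pairs, mixed and sorted vertices.

  ∈-split : ∀ {X : Set} {x : X} {xs} → x ∈ xs → ∃ λ ys → xs ↭ x ∷ ys
  ∈-split x∈xs with ∈-∃++ x∈xs
  ... | ys , zs , ≡.refl = ys ++ zs , shift _ ys zs

  all-or : ∀ {X O : Set} {P : X → Set} xs → (∀ {x} → x ∈ xs → O ⊎ P x) → O ⊎ (∀ {x} → x ∈ xs → P x)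
  all-or []       f = inj₂ λ ()
  all-or (x ∷ xs) f with f (here ≡.refl) | all-or xs (λ x∈ → f (there x∈))
  ... | inj₁ o | _      = inj₁ o
  ... | inj₂ _ | inj₁ o = inj₁ o
  ... | inj₂ p | inj₂ g = inj₂ λ { (here ≡.refl) → p ; (there x∈) → g x∈ }

  Joined : List V → List V → Set
  Joined A B = ∀ {a b} → a ∈ A → b ∈ B → E a b

  joined-swap : ∀ {A B} → Joined A B → Joined B A
  joined-swap j b a = E-sym (j a b)

  -- A vertex is sorted if it is joined to all of B (it can be added to A) or to all of A (it can be added to B).
  module Sorting (A B : List V) where

    MixedIn : V → Set
    MixedIn v = (∃ λ a → a ∈ A × ¬ E v a) × (∃ λ b → b ∈ B × ¬ E v b)

    record Sorted (n : ℕ) (xs : List V) : Set where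
      constructor sorted
      field
        {left right rest} : List V
        joinedˡ : Joined left B
        joinedʳ : Joined right A
        many    : n ≤ length left + length right
        cover   : left ++ right ++ rest ↭ xs

    sorted-none : ∀ {xs} → Sorted 0 xs
    sorted-none = sorted {left = []} {[]} (λ ()) (λ ()) z≤n refl

    sorted-++ : ∀ {m n xs ys} → Sorted m xs → Sorted n ys → Sorted (m + n) (xs ++ ys)
    sorted-++ {m} {n} (sorted {l} {r} {s} jl jr le c) (sorted {l′} {r′} {s′} jl′ jr′ le′ c′) =
      sorted {left = l ++ l′} {r ++ r′} {s ++ s′}
        (λ v b → Sum.[ (λ u → jl u b) , (λ u → jl′ u b) ]′ (∈-++⁻ l v))
        (λ v a → Sum.[ (λ u → jr u a) , (λ u → jr′ u a) ]′ (∈-++⁻ r v))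
        (≤-trans (+-mono-≤ le le′) (≤-reflexive (≡.trans (interchange (length l) (length r) (length l′) (length r′))
          (≡.sym (cong₂ _+_ (length-++ l) (length-++ r))))))
        (trans (solve 6 (λ l l′ r r′ s s′ → (l ⊕ l′) ⊕ (r ⊕ r′) ⊕ (s ⊕ s′) ⊜ (l ⊕ r ⊕ s) ⊕ (l′ ⊕ r′ ⊕ s′)) refl l l′ r r′ s s′)
          (++⁺ c c′))
      where
      open CommutativeSemigroup +-commutativeSemigroup using (interchange)

    kind : ∀ v → MixedIn v ⊎ Sorted 1 [ v ]
    kind v with All.all? (E? v) A | All.all? (E? v) B
    ... | _ | yes vB = inj₂ (sorted {left = [ v ]} {[]} {[]} (λ { (here ≡.refl) b → All.lookup vB b }) (λ ()) ≤-refl refl)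
    ... | yes vA | no _ = inj₂ (sorted {left = []} {[ v ]} {[]} (λ ()) (λ { (here ≡.refl) a → All.lookup vA a }) ≤-refl refl)
    ... | no ¬vA | no ¬vB = inj₁ (find (All.¬All⇒Any¬ (E? v) A ¬vA) , find (All.¬All⇒Any¬ (E? v) B ¬vB))

    triple : ∀ x y c → TwoOf MixedIn x y c ⊎ Sorted 2 (x ∷ y ∷ c ∷ [])
    triple x y c with kind x | kind y | kind c
    ... | inj₁ p | inj₁ q | _      = inj₁ (first-second p q)
    ... | inj₁ p | inj₂ _ | inj₁ r = inj₁ (first-third p r)
    ... | inj₂ _ | inj₁ q | inj₁ r = inj₁ (second-third q r)
    ... | inj₁ _ | inj₂ q | inj₂ r = inj₂ (sorted-++ (sorted-none {[ x ]}) (sorted-++ q r))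
    ... | inj₂ p | inj₁ _ | inj₂ r = inj₂ (sorted-++ p (sorted-++ (sorted-none {[ y ]}) r))
    ... | inj₂ p | inj₂ q | _      = inj₂ (sorted-++ p (sorted-++ q (sorted-none {[ c ]})))

    scan : ∀ {Q} → All Seagull Q →
           (∃₂ λ x y → ∃₂ λ c Q′ → Q ↭ (x ∷ y ∷ c ∷ []) ∷ Q′ × TwoOf MixedIn x y c) ⊎
           Sorted (length Q * 2) (concat Q)
    scan [] = inj₂ sorted-none
    scan (seagull {x} {y} {c} _ _ _ ∷ ss) with triple x y c | scan ss
    ... | inj₁ t | _ = inj₁ (x , y , c , _ , refl , t)
    ... | inj₂ s | inj₂ s′ = inj₂ (sorted-++ s s′)
    ... | inj₂ _ | inj₁ (x′ , y′ , c′ , Q′ , p , t) =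
      inj₁ (x′ , y′ , c′ , _ , trans (prep _ p) (swap _ _ refl) , t)

  -- Enlarging a packing beside a completely joined pair.

  module Augmentation (U : List V) (w : ℕ)
    (join-bound : ∀ {A B r a b} → a ∈ A → b ∈ B → A ++ B ++ r ↭ U → Joined A B → length A + length B ≤ w) where
    open Augment U w

    -- The edges in F still lack a third vertex, and any vertex of A or B will do for them.
    record Config (A B : List V) (F Q : List (List V)) : Set where
      constructor config
      field
        cover    : A ++ B ++ concat F ++ concat Q ↭ U
        joined   : Joined A B
        edges    : All Edge F
        detached : Detached (concat F) (A ++ B)
        gulls    : All Seagull Q
        room     : 3 + length F ≤ length A + length B
        tight    : w < length A + length B + length Q

    config-swap : ∀ {A B F Q} → Config A B F Q → Config B A F Q
    config-swap {A} {B} {F} {Q} (config cov j es det ss room tight) = config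
      (trans (solve 4 (λ a b f q → b ⊕ a ⊕ f ⊕ q ⊜ a ⊕ b ⊕ f ⊕ q) refl A B (concat F) (concat Q)) cov)
      (joined-swap j) es (λ v z → det v (∈-resp-↭ (++-comm B A) z)) ss
      (≤-trans room (≤-reflexive (+-comm (length A) (length B))))
      (≤-trans tight (≤-reflexive (cong (_+ length Q) (+-comm (length A) (length B)))))

    config-resp : ∀ {A A′ B B′ F Q Q′} → A ↭ A′ → B ↭ B′ → Q ↭ Q′ → Config A B F Q → Config A′ B′ F Q′
    config-resp {F = F} p q s (config cov j es det ss room tight) = config
      (trans (++⁺ (↭-sym p) (++⁺ (↭-sym q) (++⁺ˡ (concat F) (concat-↭ (↭-sym s))))) cov)
      (λ a b → j (∈-resp-↭ (↭-sym p) a) (∈-resp-↭ (↭-sym q) b)) es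
      (λ v z → det v (∈-resp-↭ (↭-sym (++⁺ p q)) z)) (All-resp-↭ s ss)
      (≤-trans room (≤-reflexive lengths))
      (≤-trans tight (≤-reflexive (cong₂ _+_ lengths (↭-length s))))
      where lengths = cong₂ _+_ (↭-length p) (↭-length q)

    Pendant : (a b a′ x y c : V) → Set
    Pendant a b a′ x y c = Avoids a b a′ x × Avoids a b a′ y × E c b

    -- Apart from the pendant, every outcome of the local exchange reaches the required number once
    -- each waiting edge receives a vertex of `A` or `B` off the path.
    resolve : ∀ {a b a′ x y c A B F Q} → Config (a ∷ a′ ∷ A) (b ∷ B) F ((x ∷ y ∷ c ∷ []) ∷ Q) →
              TwoOf (Mixed a b a′) x y c → Outcome (2 + (length F + length Q)) ⊎ Pendant a b a′ x y c
    resolve {a} {b} {a′} {x} {y} {c} {A} {B} {F} {Q} (config cov j es det (s@(seagull xy ¬xc ¬yc) ∷ ss) room tight) t =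
      by (local ab a′b s t)
      where
      ab : E a b
      ab = j (here ≡.refl) (here ≡.refl)
      a′b : E a′ b
      a′b = j (there (here ≡.refl)) (here ≡.refl)

      cover : a ∷ b ∷ a′ ∷ x ∷ y ∷ c ∷ (A ++ B) ++ concat F ++ concat Q ↭ U
      cover = trans (solve 10 (λ a b a′ x y c A B F Q →
        a ⊕ b ⊕ a′ ⊕ x ⊕ y ⊕ c ⊕ (A ⊕ B) ⊕ F ⊕ Q ⊜ (a ⊕ a′ ⊕ A) ⊕ (b ⊕ B) ⊕ F ⊕ (x ⊕ y ⊕ c ⊕ Q))
        refl [ a ] [ b ] [ a′ ] [ x ] [ y ] [ c ] A B (concat F) (concat Q)) cov

      side : ∀ {z} → z ∈ A ++ B → Side a b a′ z
      side z with ∈-++⁻ A z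
      ... | inj₁ z∈A = inj₁ (j (there (there z∈A)) (here ≡.refl))
      ... | inj₂ z∈B = inj₂ (E-sym (j (here ≡.refl) (there z∈B)) , E-sym (j (there (here ≡.refl)) (there z∈B)))

      det′ : Detached (concat F) (A ++ B)
      det′ v z with ∈-++⁻ A z
      ... | inj₁ z∈A = det v (there (there (∈-++⁺ˡ z∈A)))
      ... | inj₂ z∈B = det v (∈-++⁺ʳ (a ∷ a′ ∷ A) (there z∈B))

      sizes : length (a ∷ a′ ∷ A) + length (b ∷ B) ≡ 3 + length (A ++ B)
      sizes = cong (2 +_) (≡.trans (+-suc (length A) (length B)) (cong suc (≡.sym (length-++ A))))

      -- The path `a b a′` uses up three vertices of the pair; one per waiting edge is still there.
      room′ : length F ≤ length (A ++ B)
      room′ = +-cancelˡ-≤ 3 _ _ (≤-trans room (≤-reflexive sizes))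

      tight′ : w < 4 + length (A ++ B) + length Q
      tight′ = ≤-trans tight (≤-reflexive (≡.trans (cong (_+ suc (length Q)) sizes) (+-suc (3 + length (A ++ B)) (length Q))))

      by : Local a b a′ x y c → Outcome (2 + (length F + length Q)) ⊎ Pendant a b a′ x y c
      by (tiled p) = inj₁ (inj₁ (packing-resp cover (packing-++ p (fill-concat (A ++ B) es ss det′ room′))))
      by (pendant p q cb) = inj₂ (p , q , cb)
      by (wheel xa′ ya (¬ca , ¬cb , ¬ca′)) = inj₁ (wheel-augment
        (mkWheel ab (E-sym a′b) (E-sym xa′) xy ya ¬ca ¬cb ¬ca′ (non-edge ¬xc) (non-edge ¬yc))
        cover side es ss det′ room′ tight′)
      by (wheel′ xa ya′ (¬ca , ¬cb , ¬ca′)) = inj₁ (wheel-augment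
        (mkWheel ab (E-sym a′b) (E-sym ya′) (E-sym xy) xa ¬ca ¬cb ¬ca′ (non-edge ¬yc) (non-edge ¬xc))
        (trans (prep a (prep b (prep a′ (swap y x refl)))) cover) side es ss det′ room′ tight′)

    -- Splitting a seagull moves it from `Q` to `F`, so the target `suc (length F + length Q)` stays
    -- fixed while the number `q` of intact seagulls, the induction parameter, drops.
    Augmentable : ℕ → Set
    Augmentable q = ∀ {A B F Q a b} → a ∈ A → b ∈ B → length Q ≡ q → Config A B F Q → Outcome (suc (length F + length Q))

    -- If a waiting edge `pq` has `p` adjacent to the new leaf `c`, the nine vertices involved split
    -- into `pc` with `a′`, `a₃b` with `q`, and `xy` with `a`. This replaces one seagull and one
    -- waiting edge by three seagulls.
    three-with-edge : ∀ {a b a′ x y c p q A F Q} →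
      Config (a ∷ a′ ∷ A) [ b ] F ((x ∷ y ∷ c ∷ []) ∷ Q) → Pendant a b a′ x y c →
      ∀ {F′} → length F ≡ suc (length F′) → concat F ↭ p ∷ q ∷ concat F′ → All Edge F′ → E p c → Outcome (2 + (length F + length Q))
    -- A waiting edge and `room` force a third leaf `a₃`.
    three-with-edge {A = []} cfg pend F≡ _ _ _ =
      ⊥-elim (1+n≰n (≤-trans (≤-reflexive (cong (3 +_) (≡.sym F≡))) (≤-trans (Config.room cfg) (s≤s (s≤s (s≤s z≤n))))))
    three-with-edge {a} {b} {a′} {x} {y} {c} {p} {q} {a₃ ∷ A} {F} {Q}
      (config cov j es det (seagull xy ¬xc ¬yc ∷ ss) room tight) ((¬xa , _) , (¬ya , _) , cb) {F′} F≡ F↭ es′ pc =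
      inj₁ (packing-count count (packing-resp cover
        (packing-++ (three (seagull pc (¬F p∈F (there (here ≡.refl))) (apart cb (j (there (here ≡.refl)) (here ≡.refl))))
                           (seagull (j (there (there (here ≡.refl))) (here ≡.refl))
                             (non-edge (¬F q∈F (there (there (here ≡.refl)))))
                             (non-edge (¬F q∈F (there (there (there (∈-++⁺ʳ A (here ≡.refl))))))))
                           (seagull xy ¬xa ¬ya) refl)
          (fill-concat A es′ ss det′ room′))))
      where
      ¬F : Detached (p ∷ q ∷ concat F′) (a ∷ a′ ∷ (a₃ ∷ A) ++ [ b ])
      ¬F v = det (∈-resp-↭ (↭-sym F↭) v)
      p∈F : p ∈ p ∷ q ∷ concat F′
      p∈F = here ≡.refl
      q∈F : q ∈ p ∷ q ∷ concat F′
      q∈F = there (here ≡.refl)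
      det′ : Detached (concat F′) A
      det′ v z = ¬F (there (there v)) (there (there (there (∈-++⁺ˡ z))))
      room′ : length F′ ≤ length A
      room′ = +-cancelˡ-≤ 4 _ _ (≤-trans (≤-reflexive (cong (3 +_) (≡.sym F≡)))
        (≤-trans room (≤-reflexive (cong (3 +_) (+-comm (length A) 1)))))
      count : 3 + (length F′ + length Q) ≡ 2 + (length F + length Q)
      count = cong (λ n → 2 + (n + length Q)) (≡.sym F≡)
      cover : p ∷ c ∷ a′ ∷ a₃ ∷ b ∷ q ∷ x ∷ y ∷ a ∷ A ++ concat F′ ++ concat Q ↭ U
      cover = trans (trans (solve 12 (λ p q a b a′ a₃ x y c A F′ Q →
        p ⊕ c ⊕ a′ ⊕ a₃ ⊕ b ⊕ q ⊕ x ⊕ y ⊕ a ⊕ A ⊕ F′ ⊕ Q ⊜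
        (a ⊕ a′ ⊕ a₃ ⊕ A) ⊕ b ⊕ (p ⊕ q ⊕ F′) ⊕ (x ⊕ y ⊕ c ⊕ Q)) refl
        [ p ] [ q ] [ a ] [ b ] [ a′ ] [ a₃ ] [ x ] [ y ] [ c ] A (concat F′) (concat Q))
        (++⁺ˡ (a ∷ a′ ∷ a₃ ∷ A) (prep b (++⁺ʳ (x ∷ y ∷ c ∷ concat Q) (↭-sym F↭))))) cov

    -- Needed for `c` to join the leaves: waiting edges must remain detached from it.
    pendant-edges : ∀ {a b a′ x y c A F Q} →
      Config (a ∷ a′ ∷ A) [ b ] F ((x ∷ y ∷ c ∷ []) ∷ Q) → Pendant a b a′ x y c →
      Outcome (2 + (length F + length Q)) ⊎ (∀ {f} → f ∈ F → All (λ v → ¬ E v c) f)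
    pendant-edges {c = c} {F = F} {Q} cfg pend = all-or F check
      where
      check : ∀ {f} → f ∈ F → Outcome (2 + (length F + length Q)) ⊎ All (λ v → ¬ E v c) f
      check f∈F with All.lookup (Config.edges cfg) f∈F | ∈-split f∈F
      ... | edge {p} {q} pq | F′ , F↭ with E? p c | E? q c
      ...   | no ¬pc | no ¬qc = inj₂ (¬pc ∷ ¬qc ∷ [])
      ...   | yes pc | _ = inj₁ (three-with-edge cfg pend (↭-length F↭) (concat-↭ F↭) es′ pc)
        where es′ = All.tail (All-resp-↭ F↭ (Config.edges cfg))
      ...   | no _ | yes qc = inj₁ (three-with-edge cfg pend (↭-length F↭) (trans (concat-↭ F↭) (swap p q refl)) es′ qc)
        where es′ = All.tail (All-resp-↭ F↭ (Config.edges cfg))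

    -- `x` and `y` miss `a` and `b`, so they are mixed for the path `a b z` with any other leaf `z`
    -- too. If that exchange gains nothing it is again pendant, and then both miss `z`.
    pendant-leaves : ∀ {a b a′ x y c A B F Q} →
      Config (a ∷ a′ ∷ A) (b ∷ B) F ((x ∷ y ∷ c ∷ []) ∷ Q) → Pendant a b a′ x y c →
      Outcome (2 + (length F + length Q)) ⊎ (∀ {z} → z ∈ A → ¬ E x z × ¬ E y z)
    pendant-leaves {a} {b} {a′} {x} {y} {c} {A} {F = F} {Q} cfg ((¬xa , ¬xb , _) , (¬ya , ¬yb , _) , _) = all-or A check
      where
      check : ∀ {z} → z ∈ A → Outcome (2 + (length F + length Q)) ⊎ ¬ E x z × ¬ E y z
      check z∈A with ∈-split z∈A
      ... | A′ , A↭ with resolve (config-resp (prep a (trans (prep a′ A↭) (swap _ _ refl))) refl refl cfg)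
                           (first-second (¬xb , inj₁ ¬xa) (¬yb , inj₁ ¬ya))
      ...   | inj₁ o = inj₁ o
      ...   | inj₂ ((_ , _ , ¬xz) , (_ , _ , ¬yz) , _) = inj₂ (¬xz , ¬yz)

    -- The seagull is split: c becomes a new leaf and xy an edge waiting for a third vertex.
    absorb : ∀ {q a b a′ x y c A F Q} → Augmentable q → length Q ≡ q →
      Config (a ∷ a′ ∷ A) [ b ] F ((x ∷ y ∷ c ∷ []) ∷ Q) → Pendant a b a′ x y c →
      (∀ {z} → z ∈ A → ¬ E x z × ¬ E y z) → (∀ {f} → f ∈ F → All (λ v → ¬ E v c) f) →
      Outcome (2 + (length F + length Q))
    absorb {q} {a} {b} {a′} {x} {y} {c} {A} {F} {Q} augment Q≡
      (config cov j es det (seagull xy ¬xc ¬yc ∷ ss) room tight)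
      ((¬xa , ¬xb , ¬xa′) , (¬ya , ¬yb , ¬ya′) , cb) leaves ¬Fc =
      augment {c ∷ a ∷ a′ ∷ A} {[ b ]} {(x ∷ y ∷ []) ∷ F} {Q} (here ≡.refl) (here ≡.refl) Q≡ (config
        (trans (solve 9 (λ a b a′ x y c A F Q → (c ⊕ a ⊕ a′ ⊕ A) ⊕ b ⊕ (x ⊕ y ⊕ F) ⊕ Q ⊜
          (a ⊕ a′ ⊕ A) ⊕ b ⊕ F ⊕ (x ⊕ y ⊕ c ⊕ Q)) refl [ a ] [ b ] [ a′ ] [ x ] [ y ] [ c ] A (concat F) (concat Q)) cov)
        joined (edge xy ∷ es) detached ss (s≤s room)
        (≤-trans tight (≤-reflexive (+-suc (length (a ∷ a′ ∷ A) + 1) (length Q)))))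
      where
      joined : Joined (c ∷ a ∷ a′ ∷ A) [ b ]
      joined (here ≡.refl) (here ≡.refl) = cb
      joined (there v) w = j v w

      avoid : ∀ {v} → Avoids a b a′ v → ¬ E v c → (∀ {z} → z ∈ A → ¬ E v z) →
              ∀ {z} → z ∈ c ∷ a ∷ a′ ∷ A ++ [ b ] → ¬ E v z
      avoid _ ¬vc _ (here ≡.refl) = ¬vc
      avoid (¬va , _) _ _ (there (here ≡.refl)) = ¬va
      avoid (_ , _ , ¬va′) _ _ (there (there (here ≡.refl))) = ¬va′
      avoid (_ , ¬vb , _) _ ¬vA (there (there (there z))) with ∈-++⁻ A z
      ... | inj₁ z∈A = ¬vA z∈A
      ... | inj₂ (here ≡.refl) = ¬vb

      detached : Detached (x ∷ y ∷ concat F) (c ∷ a ∷ a′ ∷ A ++ [ b ])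
      detached (here ≡.refl) z = avoid (¬xa , ¬xb , ¬xa′) ¬xc (λ z → proj₁ (leaves z)) z
      detached (there (here ≡.refl)) z = avoid (¬ya , ¬yb , ¬ya′) ¬yc (λ z → proj₂ (leaves z)) z
      detached (there (there v)) (here ≡.refl) with ∈-concat⁻′ F v
      ... | f , v∈f , f∈F = All.lookup (¬Fc f∈F) v∈f
      detached (there (there v)) (there z) = det v z

    -- A second vertex `z` on the side of `b` gives the path `b a z`. Were it pendant as well, `c`
    -- would be adjacent to both ends of `ab`. So the seagull is absorbed only when `b` is alone on
    -- its side.
    pendant-step : ∀ {q a b a′ x y c A B F Q} → Augmentable q → length Q ≡ q →
      Config (a ∷ a′ ∷ A) (b ∷ B) F ((x ∷ y ∷ c ∷ []) ∷ Q) → Pendant a b a′ x y c →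
      Outcome (2 + (length F + length Q))
    pendant-step {B = []} augment Q≡ cfg pend with pendant-leaves cfg pend | pendant-edges cfg pend
    ... | inj₁ o | _ = o
    ... | inj₂ _ | inj₁ o = o
    ... | inj₂ leaves | inj₂ ¬Fc = absorb augment Q≡ cfg pend leaves ¬Fc
    pendant-step {B = z ∷ B} augment Q≡ cfg ((¬xa , ¬xb , _) , (¬ya , ¬yb , _) , cb)
      with resolve (config-swap cfg) (first-second (¬xa , inj₁ ¬xb) (¬ya , inj₁ ¬yb))
    ... | inj₁ o = o
    ... | inj₂ (_ , _ , ca) = ⊥-elim (E-tri ca (Config.joined cfg (here ≡.refl) (here ≡.refl)) cb)

    -- A path for which both vertices are mixed at once, with its two leaves in `A` or in `B`.
    data Choice (A B : List V) (v v′ : V) : Set where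
      onˡ : ∀ {a b a′ A′ B′} → A ↭ a ∷ a′ ∷ A′ → B ↭ b ∷ B′ → Mixed a b a′ v → Mixed a b a′ v′ → Choice A B v v′
      onʳ : ∀ {a b b′ A′ B′} → A ↭ a ∷ A′ → B ↭ b ∷ b′ ∷ B′ → Mixed b a b′ v → Mixed b a b′ v′ → Choice A B v v′

    choice-swap : ∀ {A B v v′} → Choice A B v v′ → Choice B A v v′
    choice-swap (onˡ p q m m′) = onʳ q p m m′
    choice-swap (onʳ p q m m′) = onˡ q p m m′

    -- Both vertices miss the edge `ab`; a third vertex of the pair, on either side, supplies the
    -- second leaf.
    choose-common : ∀ {A B v v′ a b} → 3 ≤ length A + length B → a ∈ A → b ∈ B →
      ¬ E v a → ¬ E v b → ¬ E v′ a → ¬ E v′ b → Choice A B v v′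
    choose-common room a∈A b∈B ¬va ¬vb ¬v′a ¬v′b with ∈-split a∈A | ∈-split b∈B
    ... | _ ∷ _ , p | _ , q = onˡ p q (¬vb , inj₁ ¬va) (¬v′b , inj₁ ¬v′a)
    ... | [] , p | _ ∷ _ , q = onʳ p q (¬va , inj₁ ¬vb) (¬v′a , inj₁ ¬v′b)
    ... | [] , p | [] , q rewrite ↭-length p | ↭-length q = ⊥-elim (1+n≰n room)

    choose-left : ∀ {A B v v′ a a′ b} → 3 ≤ length A + length B → b ∈ B →
      ¬ E v b → ¬ E v′ b → a ∈ A → ¬ E v a → a′ ∈ A → ¬ E v′ a′ → Choice A B v v′
    choose-left room b∈B ¬vb ¬v′b a∈A ¬va a′∈A ¬v′a′ with ∈-split a∈A
    ... | A₁ , p with ∈-resp-↭ p a′∈A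
    ...   | here ≡.refl = choose-common room a∈A b∈B ¬va ¬vb ¬v′a′ ¬v′b
    ...   | there a′∈A₁ with ∈-split a′∈A₁ | ∈-split b∈B
    ...     | _ , q | _ , r = onˡ (trans p (prep _ q)) r (¬vb , inj₁ ¬va) (¬v′b , inj₂ ¬v′a′)

    -- As `a′b′` is an edge, `v` misses one of its ends; likewise `v′` misses an end of `ab`. Hence
    -- the two vertices miss a common vertex of the pair, which becomes the centre unless they miss
    -- a whole common edge.
    choose : ∀ {A B v v′} → Joined A B → 3 ≤ length A + length B →
      Sorting.MixedIn A B v → Sorting.MixedIn A B v′ → Choice A B v v′
    choose {A} {B} {v} {v′} j room ((a , a∈A , ¬va) , (b , b∈B , ¬vb)) ((a′ , a′∈A , ¬v′a′) , (b′ , b′∈B , ¬v′b′))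
      with E? v b′ | E? v′ b | E? v a′ | E? v′ a
    ... | no ¬vb′ | _ | _ | no ¬v′a = choose-common room a∈A b′∈B ¬va ¬vb′ ¬v′a ¬v′b′
    ... | _ | no ¬v′b | no ¬va′ | _ = choose-common room a′∈A b∈B ¬va′ ¬vb ¬v′a′ ¬v′b
    ... | no ¬vb′ | _ | yes _ | yes _ = choose-left room b′∈B ¬vb′ ¬v′b′ a∈A ¬va a′∈A ¬v′a′
    ... | no ¬vb′ | yes _ | no _ | yes _ = choose-left room b′∈B ¬vb′ ¬v′b′ a∈A ¬va a′∈A ¬v′a′
    ... | yes vb′ | _ | yes va′ | _ = ⊥-elim (E-tri va′ (j a′∈A b′∈B) vb′)
    ... | _ | yes v′b | _ | yes v′a = ⊥-elim (E-tri v′a (j a∈A b∈B) v′b)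
    ... | yes vb′ | yes v′b | no ¬va′ | no ¬v′a =
      choice-swap (choose-left (≤-trans room (≤-reflexive (+-comm (length A) (length B)))) a∈A ¬va ¬v′a b∈B ¬vb b′∈B ¬v′b′)

    outcome-count : ∀ {m n} → m ≡ n → Outcome m → Outcome n
    outcome-count ≡.refl o = o

    -- `L` can be added to `A`, and separately `M` to `B`. By `join-bound` and `tight` each has
    -- fewer than `length Q` vertices, so they cannot amount to two per seagull.
    not-sorted : ∀ {A B F Q a b} → a ∈ A → b ∈ B → Config A B F Q → ¬ Sorting.Sorted A B (length Q * 2) (concat Q)
    not-sorted {A} {B} {F} {Q} a∈A b∈B (config cov j es det ss room tight) (Sorting.sorted {L} {M} {R} LB MA many LMR) =
      <-irrefl ≡.refl (<-≤-trans (+-mono-< small-L small-M)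
        (≤-trans (≤-reflexive (≡.trans (cong (length Q +_) (≡.sym (+-identityʳ _))) (*-comm 2 (length Q)))) many))
      where
      open ≤-Reasoning
      coverL : (A ++ L) ++ B ++ M ++ R ++ concat F ↭ U
      coverL = trans (solve 6 (λ A B F L M R → (A ⊕ L) ⊕ B ⊕ M ⊕ R ⊕ F ⊜ A ⊕ B ⊕ F ⊕ (L ⊕ M ⊕ R)) refl A B (concat F) L M R)
        (trans (++⁺ˡ A (++⁺ˡ B (++⁺ˡ (concat F) LMR))) cov)
      coverM : A ++ (B ++ M) ++ L ++ R ++ concat F ↭ U
      coverM = trans (solve 6 (λ A B F L M R → A ⊕ (B ⊕ M) ⊕ L ⊕ R ⊕ F ⊜ A ⊕ B ⊕ F ⊕ (L ⊕ M ⊕ R)) refl A B (concat F) L M R)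
        (trans (++⁺ˡ A (++⁺ˡ B (++⁺ˡ (concat F) LMR))) cov)
      joinL : Joined (A ++ L) B
      joinL v w with ∈-++⁻ A v
      ... | inj₁ v∈A = j v∈A w
      ... | inj₂ v∈L = LB v∈L w
      joinM : Joined A (B ++ M)
      joinM v w with ∈-++⁻ B w
      ... | inj₁ w∈B = j v w∈B
      ... | inj₂ w∈M = E-sym (MA w∈M v)
      small-L : length L < length Q
      small-L = +-cancelˡ-< (length A + length B) (length L) (length Q) (begin-strict
        length A + length B + length L   ≡⟨ +-assoc (length A) (length B) (length L) ⟩
        length A + (length B + length L) ≡⟨ cong (length A +_) (+-comm (length B) (length L)) ⟩
        length A + (length L + length B) ≡⟨ +-assoc (length A) (length L) (length B) ⟨
        length A + length L + length B   ≡⟨ cong (_+ length B) (length-++ A) ⟨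
        length (A ++ L) + length B       ≤⟨ join-bound (∈-++⁺ˡ a∈A) b∈B coverL joinL ⟩
        w                                <⟨ tight ⟩
        length A + length B + length Q   ∎)
      small-M : length M < length Q
      small-M = +-cancelˡ-< (length A + length B) (length M) (length Q) (begin-strict
        length A + length B + length M   ≡⟨ +-assoc (length A) (length B) (length M) ⟩
        length A + (length B + length M) ≡⟨ cong (length A +_) (length-++ B) ⟨
        length A + length (B ++ M)       ≤⟨ join-bound a∈A (∈-++⁺ˡ b∈B) coverM joinM ⟩
        w                                <⟨ tight ⟩
        length A + length B + length Q   ∎)

    module _ {q : ℕ} {A B : List V} {F Q Q′ : List (List V)} {x y c : V}
      (augment : Augmentable q) (Q≡ : length Q ≡ suc q) (cfg : Config A B F Q)
      (Q↭ : Q ↭ (x ∷ y ∷ c ∷ []) ∷ Q′) where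

      private
        Q′≡ : length Q′ ≡ q
        Q′≡ = suc-injective (≡.trans (≡.sym (↭-length Q↭)) Q≡)

        recount : Outcome (2 + (length F + length Q′)) → Outcome (suc (length F + length Q))
        recount = outcome-count (cong suc (≡.trans (≡.sym (+-suc (length F) (length Q′)))
                    (cong (length F +_) (≡.sym (↭-length Q↭)))))

      augment-choice : ∀ {v v′} → Choice A B v v′ → (∀ {R : V → Set} → R v → R v′ → TwoOf R x y c) →
                       Outcome (suc (length F + length Q))
      augment-choice (onˡ p q m m′) two with config-resp p q Q↭ cfg
      ... | cfg′ with resolve cfg′ (two m m′)
      ...   | inj₁ o = recount o
      ...   | inj₂ pend = recount (pendant-step augment Q′≡ cfg′ pend)
      augment-choice (onʳ p q m m′) two with config-resp q p Q↭ (config-swap cfg)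
      ... | cfg′ with resolve cfg′ (two m m′)
      ...   | inj₁ o = recount o
      ...   | inj₂ pend = recount (pendant-step augment Q′≡ cfg′ pend)

      augment-mixed : TwoOf (Sorting.MixedIn A B) x y c → Outcome (suc (length F + length Q))
      augment-mixed (first-second p q) = augment-choice (choose (Config.joined cfg) room p q) first-second
        where room = ≤-trans (m≤m+n 3 (length F)) (Config.room cfg)
      augment-mixed (first-third p q) = augment-choice (choose (Config.joined cfg) room p q) first-third
        where room = ≤-trans (m≤m+n 3 (length F)) (Config.room cfg)
      augment-mixed (second-third p q) = augment-choice (choose (Config.joined cfg) room p q) second-third
        where room = ≤-trans (m≤m+n 3 (length F)) (Config.room cfg)

    -- Induction on the number of intact seagulls. Since not all can be sorted, some seagull has two
    -- mixed vertices; it is exchanged, or absorbed and the induction continues.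
    augment : ∀ q → Augmentable q
    augment q {A} {B} a∈A b∈B Q≡ cfg with Sorting.scan A B (Config.gulls cfg)
    ... | inj₂ s = ⊥-elim (not-sorted a∈A b∈B cfg s)
    augment zero a∈A b∈B Q≡ cfg | inj₁ (_ , _ , _ , _ , Q↭ , _) with ≡.trans (≡.sym Q≡) (↭-length Q↭)
    ... | ()
    augment (suc q) a∈A b∈B Q≡ cfg | inj₁ (_ , _ , _ , _ , Q↭ , t) = augment-mixed (augment q) Q≡ cfg Q↭ t

  -- Turning the edges of a matching into seagulls one by one.

  length-seagulls : ∀ {Q} → All Seagull Q → length (concat Q) ≡ length Q * 3
  length-seagulls [] = ≡.refl
  length-seagulls (seagull _ _ _ ∷ ss) = cong (3 +_) (length-seagulls ss)

  length-edges : ∀ {F} → All Edge F → length (concat F) ≡ length F * 2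
  length-edges [] = ≡.refl
  length-edges (edge _ ∷ es) = cong (2 +_) (length-edges es)

  JoinBound : List V → ℕ → Set
  JoinBound U w = ∀ {A B r a b} → a ∈ A → b ∈ B → A ++ B ++ r ↭ U → Joined A B → length A + length B ≤ w

  PentagonIn : List V → Set
  PentagonIn R = ∃₂ λ v₀ v₁ → ∃₂ λ v₂ v₃ → ∃₂ λ v₄ h → ∃ λ r →
    Wheel v₀ v₁ v₂ v₃ v₄ h × v₀ ∷ v₁ ∷ v₂ ∷ v₃ ∷ v₄ ∷ h ∷ r ↭ R

  data Sides (a b : V) (xs : List V) : Set where
    missing : ∀ {u} → u ∈ xs → ¬ E a u → ¬ E b u → Sides a b xs
    sides   : ∀ {L M} → L ++ M ↭ xs → (∀ {u} → u ∈ L → E u a) → (∀ {u} → u ∈ M → E u b) → Sides a b xs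

  sides-of : ∀ a b xs → Sides a b xs
  sides-of a b [] = sides {L = []} {[]} refl (λ ()) (λ ())
  sides-of a b (x ∷ xs) with sides-of a b xs | E? x a | E? x b
  ... | missing u∈ ¬au ¬bu | _ | _ = missing (there u∈) ¬au ¬bu
  ... | sides _ _ _ | no ¬xa | no ¬xb = missing (here ≡.refl) (non-edge ¬xa) (non-edge ¬xb)
  ... | sides {L} {M} p la mb | yes xa | _ =
    sides {L = x ∷ L} {M} (prep x p) (λ { (here ≡.refl) → xa ; (there u) → la u }) mb
  ... | sides {L} {M} p la mb | no _ | yes xb =
    sides {L = L} {x ∷ M} (trans (shift x L M) (prep x p)) la (λ { (here ≡.refl) → xb ; (there u) → mb u })

  -- Counts `R` as `p` seagulls, `suc j` edges and the leftover vertices. For the pair `a ∷ M`,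
  -- `b ∷ L` it gives `|A| + |B| + p = w + 1`, so `tight` holds with nothing to spare.
  stage-count : ∀ p j l m w {k r} → p * 3 + (2 + j * 2) + (l + m) ≡ r → suc r ≡ k + k + w → suc j + p ≡ k →
                suc m + suc l + p ≡ suc w
  stage-count p j l m w ≡.refl size ≡.refl =
    +-cancelˡ-≡ K _ _ (≡.trans (regroup p j l m) (≡.trans (cong suc size) (≡.sym (+-suc K w))))
    where
    K = (suc j + p) + (suc j + p)
    regroup : ∀ p j l m → (suc j + p) + (suc j + p) + (suc m + suc l + p) ≡ suc (suc (p * 3 + (2 + j * 2) + (l + m)))
    regroup = solve-∀

  module SeagullsIn (R : List V) (w k : ℕ) (join-bound : JoinBound R w)
    (no-pentagon : w ≤ 3 → ¬ PentagonIn R) (size : suc (length R) ≡ k + k + w) (k<w : k < w) where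

    record Stage (p j : ℕ) : Set where
      constructor stage
      field
        {Q F}  : List (List V)
        {rest} : List V
        countQ : length Q ≡ p
        countF : length F ≡ j
        gulls  : All Seagull Q
        edges  : All Edge F
        cover  : concat Q ++ concat F ++ rest ↭ R

    advance-join : ∀ {p j Q F L M a b} → suc j + p ≡ k → length Q ≡ p → length F ≡ j → All Seagull Q → All Edge F →
      E a b → concat Q ++ (a ∷ b ∷ concat F) ++ L ++ M ↭ R → (∀ {u} → u ∈ L → E u a) → (∀ {u} → u ∈ M → E u b) →
      (∀ {u} → u ∈ L → ∀ {v} → v ∈ M → E u v) → Stage (suc p) j
    advance-join {p} {j} {Q} {F} {L} {M} {a} {b} total Q≡ F≡ ss es ab cov La Mb LM =
      finish (augment p (here ≡.refl) (here ≡.refl) Q≡ (config refl joined [] (λ ()) ss room tight))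
      where
      -- The other `j` edges are set aside and stay untouched.
      U = (a ∷ M) ++ (b ∷ L) ++ [] ++ concat Q
      coverU : U ++ concat F ↭ R
      coverU = trans (solve 6 (λ Q F L M a b → ((a ⊕ M) ⊕ (b ⊕ L) ⊕ Q) ⊕ F ⊜ Q ⊕ (a ⊕ b ⊕ F) ⊕ (L ⊕ M)) refl
        (concat Q) (concat F) L M [ a ] [ b ]) cov
      join-bound′ : JoinBound U w
      join-bound′ {A} {B} {r} a∈A b∈B A++B j = join-bound a∈A b∈B
        (trans (solve 4 (λ A B r F → A ⊕ B ⊕ (r ⊕ F) ⊜ (A ⊕ B ⊕ r) ⊕ F) refl A B r (concat F))
          (trans (++⁺ʳ (concat F) A++B) coverU)) j
      open Augmentation U w join-bound′
      open Augment U w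
      joined : Joined (a ∷ M) (b ∷ L)
      joined (here ≡.refl) (here ≡.refl) = ab
      joined (here ≡.refl) (there v) = E-sym (La v)
      joined (there v) (here ≡.refl) = Mb v
      joined (there v) (there u) = E-sym (LM u v)
      lengths : p * 3 + (2 + j * 2) + (length L + length M) ≡ length R
      lengths = ≡.trans (cong₂ (λ q f → q + (2 + f) + (length L + length M))
          (≡.trans (cong (_* 3) (≡.sym Q≡)) (≡.sym (length-seagulls ss))) (≡.trans (cong (_* 2) (≡.sym F≡)) (≡.sym (length-edges es))))
        (≡.trans (+-assoc (length (concat Q)) _ _) (≡.trans
          (cong (λ n → length (concat Q) + suc (suc (length (concat F) + n))) (≡.sym (length-++ L)))
          (≡.trans (≡.sym (≡.trans (length-++ (concat Q)) (cong (λ n → length (concat Q) + suc (suc n)) (length-++ (concat F)))))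
            (↭-length cov))))
      count : suc (length M) + suc (length L) + p ≡ suc w
      count = stage-count p j (length L) (length M) w lengths size total
      -- From `p < k < w` the sum `|A| + |B| = w + 1 - p` is at least 3.
      room : 3 ≤ suc (length M) + suc (length L)
      room = +-cancelʳ-≤ p _ _ (≤-trans (s≤s (≤-trans (s≤s (≤-trans (s≤s (m≤n+m p j)) (≤-reflexive total))) k<w))
        (≤-reflexive (≡.sym count)))
      tight : w < suc (length M) + suc (length L) + length Q
      tight = ≤-reflexive (≡.trans (≡.sym count) (cong (suc (length M) + suc (length L) +_) (≡.sym Q≡)))
      finish : Outcome (suc (length Q)) → Stage (suc p) j
      finish (inj₁ (packing {Q′} {r} Q′≡ ss′ cov′)) = stage (≡.trans Q′≡ (cong suc Q≡)) F≡ ss′ es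
        (trans (solve 3 (λ Q F r → Q ⊕ F ⊕ r ⊜ (Q ⊕ r) ⊕ F) refl (concat Q′) (concat F) r) (trans (++⁺ʳ (concat F) cov′) coverU))
      finish (inj₂ (w≤3 , v₀ , v₁ , v₂ , v₃ , v₄ , h , W , cov′)) =
        ⊥-elim (no-pentagon w≤3 (v₀ , v₁ , v₂ , v₃ , v₄ , h , concat F , W , trans (++⁺ʳ (concat F) cov′) coverU))

    -- A leftover vertex missing both `a` and `b` completes `ab` at once. Otherwise the leftover
    -- vertices split into neighbours `L` of `a` and `M` of `b`. A non-adjacent `u` in `L` and `v`
    -- in `M` give the seagull `u a v`; if there is none, `a ∷ M` and `b ∷ L` are completely joined.
    advance : ∀ {p j} → suc j + p ≡ k → Stage p (suc j) → Stage (suc p) j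
    advance {p} {j} total (stage {Q} {(a ∷ b ∷ []) ∷ F} {rest} Q≡ F≡ ss (edge ab ∷ es) cov) with sides-of a b rest
    ... | missing {u} u∈ ¬au ¬bu with ∈-split u∈
    ...   | rest′ , p = stage {Q = (a ∷ b ∷ u ∷ []) ∷ Q} {F} {rest′} (cong suc Q≡) (suc-injective F≡) (seagull ab ¬au ¬bu ∷ ss) es
        (trans (trans (solve 6 (λ a b u Q F r → (a ⊕ b ⊕ u ⊕ Q) ⊕ F ⊕ r ⊜ Q ⊕ (a ⊕ b ⊕ F) ⊕ (u ⊕ r)) refl
          [ a ] [ b ] [ u ] (concat Q) (concat F) rest′) (++⁺ˡ (concat Q) (++⁺ˡ (a ∷ b ∷ concat F) (↭-sym p)))) cov)
    advance {p} {j} total (stage {Q} {(a ∷ b ∷ []) ∷ F} {rest} Q≡ F≡ ss (edge ab ∷ es) cov) | sides {L} {M} LM La Mb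
      with all-or L (λ {u} u∈L → all-or M (λ {v} v∈M → unjoined u∈L v∈M (E? u v)))
      where
      unjoined : ∀ {u v} → u ∈ L → v ∈ M → Dec (E u v) → Stage (suc p) j ⊎ E u v
      unjoined _ _ (yes uv) = inj₂ uv
      unjoined {u} {v} u∈L v∈M (no ¬uv) with ∈-split u∈L | ∈-split v∈M
      ... | L′ , l | M′ , m = inj₁ (stage {Q = (u ∷ a ∷ v ∷ []) ∷ Q} {F} {b ∷ L′ ++ M′} (cong suc Q≡) (suc-injective F≡)
        (seagull (La u∈L) ¬uv (apart ab (Mb v∈M)) ∷ ss) es
        (trans (trans (solve 8 (λ a b u v L M Q F → (u ⊕ a ⊕ v ⊕ Q) ⊕ F ⊕ (b ⊕ L ⊕ M) ⊜ Q ⊕ (a ⊕ b ⊕ F) ⊕ ((u ⊕ L) ⊕ (v ⊕ M))) refl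
          [ a ] [ b ] [ u ] [ v ] L′ M′ (concat Q) (concat F))
          (++⁺ˡ (concat Q) (++⁺ˡ (a ∷ b ∷ concat F) (trans (++⁺ (↭-sym l) (↭-sym m)) LM)))) cov))
    ... | inj₁ s = s
    ... | inj₂ LM-joined = advance-join total Q≡ (suc-injective F≡) ss es ab
      (trans (++⁺ˡ (concat Q) (++⁺ˡ (a ∷ b ∷ concat F) LM)) cov) La Mb LM-joined

    advance-all : ∀ {p} j → j + p ≡ k → Stage p j → Stage k 0
    advance-all zero ≡.refl s = s
    advance-all {p} (suc j) total s = advance-all j (≡.trans (+-suc j p) total) (advance total s)

    seagulls : Packing Edge k R → Packing Seagull k R
    seagulls (packing {F} {rest} F≡ es cov) with advance-all k (+-identityʳ k) (stage {Q = []} ≡.refl F≡ [] es cov)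
    ... | stage Q≡ _ ss _ cov′ = packing Q≡ ss cov′

  -- Matchings and alternating paths.

  ∷-cases : ∀ {X : Set} {x y : X} {xs ys} → x ∷ xs ↭ y ∷ ys →
            (x ≡ y × xs ↭ ys) ⊎ (∃ λ zs → xs ↭ y ∷ zs × ys ↭ x ∷ zs)
  ∷-cases {x = x} {y} p with ∈-resp-↭ p (here ≡.refl)
  ... | here ≡.refl = inj₁ (≡.refl , drop-∷ p)
  ... | there x∈ys with ∈-split x∈ys
  ...   | zs , q = inj₂ (zs , drop-∷ (trans p (trans (prep y q) (swap y x refl))) , q)

  Matching : ℕ → List V → Set
  Matching = Packing Edge

  matching-∷ : ∀ {a b t xs ys} → E a b → a ∷ b ∷ xs ↭ ys → Matching t xs → Matching (suc t) ys
  matching-∷ ab p m = packing-resp p (packing-∷ (edge ab) m)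

  record Matched (t : ℕ) (v : V) (xs : List V) : Set where
    constructor matched
    field
      {size}   : ℕ
      {mate}   : V
      {others} : List V
      size≡    : t ≡ suc size
      adjacent : E v mate
      cover    : xs ↭ mate ∷ others
      matching : Matching size others

  mate-of : ∀ {t v xs} → Matching t (v ∷ xs) → Matching t xs ⊎ Matched t v xs
  mate-of {v = v} {xs} (packing {F} {r} F≡ es cov) with ∈-++⁻ (concat F) (∈-resp-↭ (↭-sym cov) (here ≡.refl))
  ... | inj₂ v∈r with ∈-split v∈r
  ...   | r′ , p = inj₁ (packing F≡ es (drop-∷ (trans (trans (↭-sym (shift v (concat F) r′)) (++⁺ˡ (concat F) (↭-sym p))) cov)))
  mate-of {v = v} {xs} (packing {F} {r} F≡ es cov) | inj₁ v∈F with ∈-concat⁻′ F v∈F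
  ... | f , v∈f , f∈F with ∈-split f∈F
  ...   | F′ , p = inj₂ (by v∈f (All-resp-↭ p es))
    where
    cov′ : concat (f ∷ F′) ++ r ↭ v ∷ xs
    cov′ = trans (++⁺ʳ r (concat-↭ (↭-sym p))) cov
    F′≡ = ≡.trans (≡.sym F≡) (↭-length p)
    by : v ∈ f → All Edge (f ∷ F′) → Matched _ v xs
    by (here ≡.refl) (edge ab ∷ es′) = matched F′≡ ab (↭-sym (drop-∷ cov′)) (packing ≡.refl es′ refl)
    by (there (here ≡.refl)) (edge {a} {b} ab ∷ es′) =
      matched F′≡ (E-sym ab) (↭-sym (drop-∷ (trans (swap b a refl) cov′))) (packing ≡.refl es′ refl)

  -- The alternating path from w in the union of a matching of Y and a matching of W either augments the second
  -- matching or ends at a vertex missed by the first, which is then switched along it.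
  exchange : ∀ r {s u v w Y W} → u ∷ v ∷ Y ↭ w ∷ W → Matching r Y → Matching s W →
    Matching (suc s) (u ∷ v ∷ Y) ⊎ (∃ λ Z → W ↭ u ∷ Z × Matching r Z) ⊎ (∃ λ Z → W ↭ v ∷ Z × Matching r Z)
  exchange r {s} {u} {v} {w} {Y} {W} p M N with ∷-cases p
  ... | inj₁ (≡.refl , q) = inj₂ (inj₂ (Y , ↭-sym q , M))
  ... | inj₂ (Z₀ , q , W↭) with ∷-cases q
  ...   | inj₁ (≡.refl , q′) = inj₂ (inj₁ (Z₀ , W↭ , packing-resp q′ M))
  ...   | inj₂ (Z₁ , Y↭ , Z₀↭) with mate-of (packing-resp Y↭ M)
  ...     | inj₁ M′ = inj₂ (inj₁ (v ∷ Z₁ , trans W↭ (prep u Z₀↭) , packing-+ˡ [ v ] M′))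
  ...     | inj₂ (matched {r′} {w₁} {Z₂} ≡.refl ww₁ Z₁↭ M′) = continue (mate-of (packing-resp W↭w₁ N))
    where
    W↭w₁ : W ↭ w₁ ∷ u ∷ v ∷ Z₂
    W↭w₁ = trans W↭ (trans (prep u (trans Z₀↭ (prep v Z₁↭))) (shift w₁ (u ∷ v ∷ []) Z₂))
    whole : w ∷ w₁ ∷ u ∷ v ∷ Z₂ ↭ u ∷ v ∷ Y
    whole = trans (↭-sym (shifts (u ∷ v ∷ []) (w ∷ w₁ ∷ [])))
      (prep u (prep v (trans (prep w (↭-sym Z₁↭)) (↭-sym Y↭))))
    Result : Set
    Result = Matching (suc s) (u ∷ v ∷ Y) ⊎ (∃ λ Z → W ↭ u ∷ Z × Matching (suc r′) Z) ⊎ (∃ λ Z → W ↭ v ∷ Z × Matching (suc r′) Z)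
    extended : ∀ {w₂ W′ x Z} → u ∷ v ∷ Z₂ ↭ w₂ ∷ W′ → W′ ↭ x ∷ Z → W ↭ x ∷ w₁ ∷ w₂ ∷ Z
    extended {w₂} {x = x} {Z} p q = trans W↭w₁ (trans (prep w₁ (trans p (prep w₂ q))) (shift x (w₁ ∷ w₂ ∷ []) Z))
    continue : Matching s (u ∷ v ∷ Z₂) ⊎ Matched s w₁ (u ∷ v ∷ Z₂) → Result
    continue (inj₁ N′) = inj₁ (matching-∷ ww₁ whole N′)
    continue (inj₂ (matched ≡.refl w₁w₂ q N′)) with exchange r′ q M′ N′
    ... | inj₁ N″ = inj₁ (matching-∷ ww₁ whole N″)
    ... | inj₂ (inj₁ (Z , q′ , M″)) = inj₂ (inj₁ (_ , extended q q′ , matching-∷ w₁w₂ refl M″))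
    ... | inj₂ (inj₂ (Z , q′ , M″)) = inj₂ (inj₂ (_ , extended q q′ , matching-∷ w₁w₂ refl M″))

  picks : ∀ xs → List (∃₂ λ (y : V) ys → xs ↭ y ∷ ys)
  picks []       = []
  picks (x ∷ xs) = (x , xs , refl) ∷ map (λ (y , ys , p) → y , x ∷ ys , trans (prep x p) (swap x y refl)) (picks xs)

  pick-∈ : ∀ {y xs} → y ∈ xs → Any (λ p → proj₁ p ≡ y) (picks xs)
  pick-∈ (here ≡.refl) = here ≡.refl
  pick-∈ (there y∈xs)  = there (Any.map⁺ (pick-∈ y∈xs))

  matching-size : ∀ {t xs} → Matching t xs → t ≤ length xs
  matching-size {t} {xs} (packing {F} {r} F≡ es cov) = begin
    t                         ≡⟨ F≡ ⟨
    length F                  ≤⟨ m≤m*n (length F) 2 ⟩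
    length F * 2              ≡⟨ length-edges es ⟨
    length (concat F)         ≤⟨ m≤m+n _ (length r) ⟩
    length (concat F) + length r ≡⟨ length-++ (concat F) ⟨
    length (concat F ++ r)    ≡⟨ ↭-length cov ⟩
    length xs                 ∎
    where open ≤-Reasoning

  matching? : ∀ t xs → Dec (Matching t xs)
  matching? t xs = search (length xs) t xs ≤-refl
    where
    search : ∀ n t xs → length xs ≤ n → Dec (Matching t xs)
    search _ zero xs _ = yes packing-zero
    search _ (suc t) [] _ = no λ m → n≮0 (matching-size m)
    search (suc n) (suc t) (x ∷ xs) (s≤s le) with search n (suc t) xs le
    ... | yes m = yes (packing-+ˡ [ x ] m)
    ... | no ¬m with any? (λ (y , ys , p) → E? x y ×-dec
        search n t ys (≤-trans (n≤1+n _) (≤-trans (≤-reflexive (≡.sym (↭-length p))) le))) (picks xs)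
    ...   | yes found with Any.satisfied found
    ...     | (y , ys , p) , xy , m = yes (matching-∷ xy (prep x (↭-sym p)) m)
    search (suc n) (suc t) (x ∷ xs) (s≤s le) | no ¬m | no ¬found = no refute
      where
      refute : ¬ Matching (suc t) (x ∷ xs)
      refute m with mate-of m
      ... | inj₁ m′ = ¬m m′
      ... | inj₂ (matched ≡.refl xy q m′) = ¬found (Any.map
        (λ { {_ , _ , p} ≡.refl → xy , packing-resp (drop-∷ (trans (↭-sym q) p)) m′ })
        (pick-∈ (∈-resp-↭ (↭-sym q) (here ≡.refl))))

  maximum : ∀ {P : ℕ → Set} → (∀ t → Dec (P t)) → P 0 → ∀ n → (∀ {t} → P t → t ≤ n) →
            ∃ λ m → P m × (∀ {t} → P t → t ≤ m)
  maximum P? p₀ zero bound = 0 , p₀ , bound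
  maximum P? p₀ (suc n) bound with P? (suc n)
  ... | yes p = suc n , p , bound
  ... | no ¬p = maximum P? p₀ n λ pt → s≤s⁻¹ (≤∧≢⇒< (bound pt) λ { ≡.refl → ¬p pt })

  -- Independent sets and neighbourhoods in a maximum one.

  Independent : List V → Set
  Independent I = ∀ {u v} → u ∈ I → v ∈ I → ¬ E u v

  record IndependentIn (k : ℕ) (X : List V) : Set where
    constructor independent
    field
      {chosen rest} : List V
      size          : length chosen ≡ k
      cover         : chosen ++ rest ↭ X
      free          : Independent chosen

  E-irrefl : ∀ {v} → ¬ E v v
  E-irrefl vv = E-tri vv vv vv

  independent-∷ : ∀ {x I} → Independent I → (∀ {v} → v ∈ I → ¬ E x v) → Independent (x ∷ I)
  independent-∷ free ¬x (here ≡.refl) (here ≡.refl) = E-irrefl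
  independent-∷ free ¬x (here ≡.refl) (there v)     = ¬x v
  independent-∷ free ¬x (there u)     (here ≡.refl) = non-edge (¬x u)
  independent-∷ free ¬x (there u)     (there v)     = free u v

  module _ {P : V → Set} (P? : Decidable P) where

    filter-split : ∀ xs → filter P? xs ++ filter (λ x → ¬? (P? x)) xs ↭ xs
    filter-split [] = refl
    filter-split (x ∷ xs) with P? x
    ... | yes _ = prep x (filter-split xs)
    ... | no _  = trans (shift x (filter P? xs) _) (prep x (filter-split xs))

  independent-size : ∀ {k X} → IndependentIn k X → k ≤ length X
  independent-size (independent {I} {r} ≡.refl cov _) =
    ≤-trans (m≤m+n _ (length r)) (≤-reflexive (≡.trans (≡.sym (length-++ I)) (↭-length cov)))

  independent-+ : ∀ {k Y} Z → IndependentIn k Y → IndependentIn k (Z ++ Y)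
  independent-+ Z (independent {I} {r} size cov free) = independent {chosen = I} {Z ++ r} size
    (trans (shifts I Z) (++⁺ˡ Z cov)) free

  non-neighbours : V → List V → List V
  non-neighbours x = filter (λ v → ¬? (E? x v))

  independent? : ∀ k X → Dec (IndependentIn k X)
  independent? k X = search (length X) k X ≤-refl
    where
    search : ∀ n k X → length X ≤ n → Dec (IndependentIn k X)
    search _ zero X _ = yes (independent {chosen = []} ≡.refl refl λ ())
    search _ (suc k) [] _ = no λ i → n≮0 (independent-size i)
    search (suc n) (suc k) (x ∷ X) (s≤s le) with search n (suc k) X le
      | search n k (non-neighbours x X) (≤-trans (length-filter (λ v → ¬? (E? x v)) X) le)
    ... | yes i | _ = yes (independent-+ [ x ] i)
    ... | no _ | yes (independent {I} {r} size cov free) = yes (independent {chosen = x ∷ I} {r ++ filter (E? x) X} (cong suc size)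
      (prep x (trans (trans (↭-sym (++-assoc I r _)) (++⁺ʳ _ cov)) (trans (++-comm (non-neighbours x X) _) (filter-split (E? x) X))))
      (independent-∷ free λ v∈I → proj₂ (∈-filter⁻ (λ v → ¬? (E? x v)) {xs = X} (∈-resp-↭ cov (∈-++⁺ˡ v∈I)))))
    ... | no ¬i | no ¬i′ = no refute
      where
      refute : ¬ IndependentIn (suc k) (x ∷ X)
      refute (independent {I} {r} size cov free) with ∈-++⁻ I (∈-resp-↭ (↭-sym cov) (here ≡.refl))
      ... | inj₂ x∈r with ∈-split x∈r
      ...   | r′ , p = ¬i (independent {chosen = I} {r′} size
              (drop-∷ (trans (↭-sym (shift x I r′)) (trans (++⁺ˡ I (↭-sym p)) cov))) free)
      refute (independent {I} {r} size cov free) | inj₁ x∈I with ∈-split x∈I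
      ... | I′ , p = ¬i′ (independent {chosen = I′} {non-neighbours x r} (suc-injective (≡.trans (≡.sym (↭-length p)) size))
        (trans (↭-reflexive (≡.trans (cong (_++ non-neighbours x r) (≡.sym (filter-all (λ v → ¬? (E? x v)) (All.tabulate ¬x))))
          (≡.sym (filter-++ (λ v → ¬? (E? x v)) I′ r)))) (filter-↭ (λ v → ¬? (E? x v)) (drop-∷ (trans (++⁺ʳ r (↭-sym p)) cov))))
        λ u v → free (∈-resp-↭ (↭-sym p) (there u)) (∈-resp-↭ (↭-sym p) (there v)))
        where
        ¬x : ∀ {v} → v ∈ I′ → ¬ E x v
        ¬x v∈ = free x∈I (∈-resp-↭ (↭-sym p) (there v∈))

  disjoint-filters : ∀ {P Q : V → Set} (P? : Decidable P) (Q? : Decidable Q) xs → (∀ {x} → x ∈ xs → P x → Q x → ⊥) →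
                     length (filter P? xs) + length (filter Q? xs) ≤ length xs
  disjoint-filters P? Q? [] _ = z≤n
  disjoint-filters P? Q? (x ∷ xs) ¬PQ with P? x | Q? x | disjoint-filters P? Q? xs (λ x∈ → ¬PQ (there x∈))
  ... | yes p | yes q | _  = ⊥-elim (¬PQ (here ≡.refl) p q)
  ... | yes _ | no _  | le = s≤s le
  ... | no _  | yes _ | le = ≤-trans (≤-reflexive (+-suc _ _)) (s≤s le)
  ... | no _  | no _  | le = m≤n⇒m≤1+n le

  Maximal : ℕ → List V → Set
  Maximal w X = ∀ {k} → IndependentIn k X → k ≤ w

  joined-independentˡ : ∀ {A B b} → b ∈ B → Joined A B → Independent A
  joined-independentˡ b∈B j u v = apart (j u b∈B) (j v b∈B)

  module MaximumIndependent {X K Y : List V} (cover : K ++ Y ↭ X) (free : Independent K) (maximal : Maximal (length K) X) where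

    neighbour-of? : ∀ A k → Dec (Any (E k) A)
    neighbour-of? A k = any? (E? k) A

    -- Otherwise exchanging A for its neighbours in K would enlarge K.
    hall : ∀ {A r} → A ++ r ↭ Y → Independent A → length A ≤ length (filter (neighbour-of? A) K)
    hall {A} {r} A⊆Y freeA = +-cancelˡ-≤ (length C) _ _ (begin
      length C + length A   ≤⟨ maximal (independent {chosen = C ++ A} {N ++ r} (length-++ C)
                                 (trans (solve 4 (λ c a n r → (c ⊕ a) ⊕ (n ⊕ r) ⊜ (n ⊕ c) ⊕ (a ⊕ r)) refl C A N r)
                                   (trans (++⁺ (filter-split (neighbour-of? A) K) A⊆Y) cover)) freeCA) ⟩
      length K              ≡⟨ ↭-length (filter-split (neighbour-of? A) K) ⟨
      length (N ++ C)       ≡⟨ length-++ N ⟩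
      length N + length C   ≡⟨ +-comm (length N) (length C) ⟩
      length C + length N   ∎)
      where
      open ≤-Reasoning
      N = filter (neighbour-of? A) K
      C = filter (λ k → ¬? (neighbour-of? A k)) K
      in-C : ∀ {v} → v ∈ C → v ∈ K × ¬ Any (E v) A
      in-C = ∈-filter⁻ (λ k → ¬? (neighbour-of? A k)) {xs = K}
      freeCA : Independent (C ++ A)
      freeCA u v with ∈-++⁻ C u | ∈-++⁻ C v
      ... | inj₁ u∈C | inj₁ v∈C = free (proj₁ (in-C u∈C)) (proj₁ (in-C v∈C))
      ... | inj₁ u∈C | inj₂ v∈A = λ uv → proj₂ (in-C u∈C) (lose v∈A uv)
      ... | inj₂ u∈A | inj₁ v∈C = λ uv → proj₂ (in-C v∈C) (lose u∈A (E-sym uv))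
      ... | inj₂ u∈A | inj₂ v∈A = freeA u∈A v∈A

    -- Each side is independent because it has a common neighbour on the other, so `hall` applies to
    -- both; a vertex of `K` adjacent to both sides would close a triangle.
    join-bound : JoinBound Y (length K)
    join-bound {A} {B} {r} a∈A b∈B A⊆Y j = ≤-trans
      (+-mono-≤ (hall A⊆Y (joined-independentˡ b∈B j))
                (hall (trans (solve 3 (λ a b r → b ⊕ a ⊕ r ⊜ a ⊕ b ⊕ r) refl A B r) A⊆Y) (joined-independentˡ a∈A (joined-swap j))))
      (disjoint-filters (neighbour-of? A) (neighbour-of? B) K λ _ → disjoint)
      where
      disjoint : ∀ {k} → Any (E k) A → Any (E k) B → ⊥
      disjoint kA kB with find kA | find kB
      ... | a , a∈ , ka | b , b∈ , kb = E-tri ka (j a∈ b∈) kb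

    chord-bound : ∀ {u v r} → u ∷ v ∷ r ↭ Y → ¬ E u v → 2 ≤ length (filter (neighbour-of? (u ∷ v ∷ [])) K)
    chord-bound uv⊆Y ¬uv = hall uv⊆Y (independent-∷ (independent-∷ (λ ()) λ ()) λ { (here ≡.refl) → ¬uv ; (there ()) })

    module _ {v₀ v₁ v₂ v₃ v₄ h : V} (W : Wheel v₀ v₁ v₂ v₃ v₄ h) where
      open Wheel W

      private
        hits : V → V → List V → ℕ
        hits u v xs = length (filter (neighbour-of? (u ∷ v ∷ [])) xs)

      chord-hits : List V → ℕ
      chord-hits xs = hits v₀ v₂ xs + (hits v₁ v₃ xs + (hits v₂ v₄ xs + (hits v₃ v₀ xs + hits v₄ v₁ xs)))

      hits-∷ : ∀ u v k xs → hits u v (k ∷ xs) ≡ hits u v [ k ] + hits u v xs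
      hits-∷ u v k xs = ≡.trans (cong length (filter-++ (neighbour-of? (u ∷ v ∷ [])) [ k ] xs))
        (length-++ (filter (neighbour-of? (u ∷ v ∷ [])) [ k ]))

      -- The neighbours of k on the pentagon are independent, so at most two, and each lies on two chords.
      chord-hits-one : ∀ k → chord-hits [ k ] ≤ 3
      chord-hits-one k with E? k v₀ | E? k v₁ | E? k v₂ | E? k v₃ | E? k v₄
      ... | yes k₀ | yes k₁ | _ | _ | _ = ⊥-elim (E-tri k₀ e₀ k₁)
      ... | _ | yes k₁ | yes k₂ | _ | _ = ⊥-elim (E-tri k₁ e₁ k₂)
      ... | _ | _ | yes k₂ | yes k₃ | _ = ⊥-elim (E-tri k₂ e₂ k₃)
      ... | _ | _ | _ | yes k₃ | yes k₄ = ⊥-elim (E-tri k₃ e₃ k₄)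
      ... | yes k₀ | _ | _ | _ | yes k₄ = ⊥-elim (E-tri k₄ e₄ k₀)
      ... | yes _ | no _ | yes _ | no _ | no _ = m≤m+n _ _
      ... | yes _ | no _ | no _ | yes _ | no _ = m≤m+n _ _
      ... | no _ | yes _ | no _ | yes _ | no _ = m≤m+n _ _
      ... | no _ | yes _ | no _ | no _ | yes _ = m≤m+n _ _
      ... | no _ | no _ | yes _ | no _ | yes _ = m≤m+n _ _
      ... | yes _ | no _ | no _ | no _ | no _ = m≤m+n _ _
      ... | no _ | yes _ | no _ | no _ | no _ = m≤m+n _ _
      ... | no _ | no _ | yes _ | no _ | no _ = m≤m+n _ _
      ... | no _ | no _ | no _ | yes _ | no _ = m≤m+n _ _
      ... | no _ | no _ | no _ | no _ | yes _ = m≤m+n _ _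
      ... | no _ | no _ | no _ | no _ | no _ = m≤m+n _ _

      chord-hits≤ : ∀ xs → chord-hits xs ≤ 3 * length xs
      chord-hits≤ [] = z≤n
      chord-hits≤ (k ∷ xs) = begin
        chord-hits (k ∷ xs)
          ≡⟨ cong₂ _+_ (hits-∷ v₀ v₂ k xs) (cong₂ _+_ (hits-∷ v₁ v₃ k xs) (cong₂ _+_ (hits-∷ v₂ v₄ k xs)
               (cong₂ _+_ (hits-∷ v₃ v₀ k xs) (hits-∷ v₄ v₁ k xs)))) ⟩
        _ ≡⟨ regroup (hits v₀ v₂ [ k ]) (hits v₁ v₃ [ k ]) (hits v₂ v₄ [ k ]) (hits v₃ v₀ [ k ]) (hits v₄ v₁ [ k ]) _ _ _ _ _ ⟩
        chord-hits [ k ] + chord-hits xs ≤⟨ +-mono-≤ (chord-hits-one k) (chord-hits≤ xs) ⟩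
        3 + 3 * length xs         ≡⟨ *-suc 3 (length xs) ⟨
        3 * length (k ∷ xs)       ∎
        where
        open ≤-Reasoning
        regroup : ∀ a b c d e a′ b′ c′ d′ e′ → a + a′ + (b + b′ + (c + c′ + (d + d′ + (e + e′)))) ≡
                  a + (b + (c + (d + e))) + (a′ + (b′ + (c′ + (d′ + e′))))
        regroup = solve-∀

    -- Double counting: each of the five chords has at least two neighbours in `K`, while each
    -- vertex of `K` is counted for at most three chords, so 10 would be at most 9.
    no-pentagon : length K ≤ 3 → ¬ PentagonIn Y
    no-pentagon w≤3 (v₀ , v₁ , v₂ , v₃ , v₄ , h , r , W , cov) = 1+n≰n (begin
      10               ≤⟨ +-mono-≤ (chord-bound (chord (0F ∷ 2F ∷ 1F ∷ 3F ∷ 4F ∷ 5F ∷ 6F ∷ [])) (apart e₀ (E-sym e₁)))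
                            (+-mono-≤ (chord-bound (chord (1F ∷ 3F ∷ 0F ∷ 2F ∷ 4F ∷ 5F ∷ 6F ∷ [])) (apart e₁ (E-sym e₂)))
                            (+-mono-≤ (chord-bound (chord (2F ∷ 4F ∷ 0F ∷ 1F ∷ 3F ∷ 5F ∷ 6F ∷ [])) (apart e₂ (E-sym e₃)))
                            (+-mono-≤ (chord-bound (chord (3F ∷ 0F ∷ 1F ∷ 2F ∷ 4F ∷ 5F ∷ 6F ∷ [])) (apart e₃ (E-sym e₄)))
                                      (chord-bound (chord (4F ∷ 1F ∷ 0F ∷ 2F ∷ 3F ∷ 5F ∷ 6F ∷ [])) (apart e₄ (E-sym e₀)))))) ⟩
      chord-hits W K   ≤⟨ chord-hits≤ W K ⟩
      3 * length K     ≤⟨ *-monoʳ-≤ 3 w≤3 ⟩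
      9                ∎)
      where
      open ≤-Reasoning
      open Wheel W
      ρ : Vec (List V) 7
      ρ = [ v₀ ] ∷ [ v₁ ] ∷ [ v₂ ] ∷ [ v₃ ] ∷ [ v₄ ] ∷ [ h ] ∷ r ∷ []
      chord : ∀ π {same} → _ ↭ Y
      chord π {same} = trans (reorder ρ π {same}) cov

  -- Ramsey and density estimates.

  ramsey : ∀ w X → Maximal w X → 2 * length X ≤ w * (w + 3)
  ramsey w [] _ = z≤n
  ramsey zero (x ∷ X) maximal = ⊥-elim (n≮0 (maximal {1} (independent {chosen = [ x ]} ≡.refl refl
    (independent-∷ (λ ()) λ ()))))
  ramsey (suc w) (x ∷ X) maximal = begin
    2 * suc (length X)                    ≡⟨ cong (λ n → 2 * suc n) (↭-length (filter-split (E? x) X)) ⟨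
    2 * suc (length (N ++ O))             ≡⟨ cong (λ n → 2 * suc n) (length-++ N) ⟩
    2 * suc (length N + length O)         ≡⟨ spread (length N) (length O) ⟩
    2 + 2 * length N + 2 * length O       ≤⟨ +-mono-≤ (+-monoʳ-≤ 2 (*-monoʳ-≤ 2 small-N)) (ramsey w O maximal-O) ⟩
    2 + 2 * suc w + w * (w + 3)           ≡⟨ recurrence w ⟩
    suc w * (suc w + 3)                   ∎
    where
    open ≤-Reasoning
    N = filter (E? x) X
    O = non-neighbours x X
    spread : ∀ n o → 2 * suc (n + o) ≡ 2 + 2 * n + 2 * o
    spread = solve-∀
    recurrence : ∀ w → 2 + 2 * suc w + w * (w + 3) ≡ suc w * (suc w + 3)
    recurrence = solve-∀
    in-N : ∀ {v} → v ∈ N → E x v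
    in-N v = proj₂ (∈-filter⁻ (E? x) {xs = X} v)
    in-O : ∀ {v} → v ∈ O → ¬ E x v
    in-O v = proj₂ (∈-filter⁻ (λ u → ¬? (E? x u)) {xs = X} v)
    small-N : length N ≤ suc w
    small-N = maximal (independent {chosen = N} {x ∷ O} ≡.refl (trans (shift x N O) (prep x (filter-split (E? x) X)))
      λ u v → apart (E-sym (in-N u)) (E-sym (in-N v)))
    maximal-O : Maximal w O
    maximal-O (independent {I} {r} size cov free) = s≤s⁻¹ (maximal (independent {chosen = x ∷ I} {r ++ N} (cong suc size)
      (prep x (trans (↭-sym (++-assoc I r N)) (trans (++⁺ʳ N cov) (trans (++-comm O N) (filter-split (E? x) X)))))
      (independent-∷ free λ v → in-O (∈-resp-↭ cov (∈-++⁺ˡ v)))))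

  -- Density alone leaves w ≤ 4 open, and these cases are excluded by the Ramsey bound.
  clique-bound : ∀ w n → 33 * suc n ≤ 124 * w → 2 * suc n ≤ w * (w + 3) → suc (suc n) < 4 * w
  clique-bound w n dense small with suc (suc n) <? 4 * w
  ... | yes lt = lt
  ... | no ¬lt = ⊥-elim (impossible w dense small (≮⇒≥ ¬lt))
    where
    open ≤-Reasoning
    small-case : ∀ w → 2 * suc n ≤ w * (w + 3) → 4 * w ≤ suc (suc n) → 2 * (4 * w) ≤ 2 + w * (w + 3)
    small-case w small le = begin
      2 * (4 * w)       ≤⟨ *-monoʳ-≤ 2 le ⟩
      2 * suc (suc n)   ≡⟨ *-suc 2 (suc n) ⟩
      2 + 2 * suc n     ≤⟨ +-monoʳ-≤ 2 small ⟩
      2 + w * (w + 3)   ∎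
    dense-case : ∀ w → 33 * suc n ≤ 124 * w → 4 * w ≤ suc (suc n) → 8 * w ≤ 33
    dense-case w dense le = +-cancelˡ-≤ (124 * w) _ _ (begin
      124 * w + 8 * w   ≡⟨ split w ⟩
      33 * (4 * w)      ≤⟨ *-monoʳ-≤ 33 le ⟩
      33 * suc (suc n)  ≡⟨ *-suc 33 (suc n) ⟩
      33 + 33 * suc n   ≤⟨ +-monoʳ-≤ 33 dense ⟩
      33 + 124 * w      ≡⟨ +-comm 33 (124 * w) ⟩
      124 * w + 33      ∎)
      where
      split : ∀ w → 124 * w + 8 * w ≡ 33 * (4 * w)
      split = solve-∀
    -- With `4 w ≤ |X| + 1`, density becomes `8 w ≤ 33`, which fails from 5 on, and the Ramsey bound
    -- becomes `8 w ≤ 2 + w (w + 3)`, which fails for 1 to 4.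
    impossible : ∀ w → 33 * suc n ≤ 124 * w → 2 * suc n ≤ w * (w + 3) → 4 * w ≤ suc (suc n) → ⊥
    impossible 0 dense _ _ = n≮0 dense
    impossible 1 _ small le = m+1+n≰m 6 (small-case 1 small le)
    impossible 2 _ small le = m+1+n≰m 12 (small-case 2 small le)
    impossible 3 _ small le = m+1+n≰m 20 (small-case 3 small le)
    impossible 4 _ small le = m+1+n≰m 30 (small-case 4 small le)
    impossible (suc (suc (suc (suc (suc w))))) dense _ le =
      m+1+n≰m 33 (≤-trans (≤-trans (m≤m+n 40 (8 * w)) (≤-reflexive (≡.sym (*-distribˡ-+ 8 5 w)))) (dense-case (5 + w) dense le))

  -- From `w ≤ k` it would follow that `4 w ≤ 2 (k + w) = 2 ν + 2 = |X| + 1`, against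
  -- `clique-bound`.
  packing-number-bound : ∀ {w k ν} → 33 * suc (ν + ν) ≤ 124 * w → 2 * suc (ν + ν) ≤ w * (w + 3) → k + w ≡ suc ν → k < w
  packing-number-bound {w} {k} {ν} dense small k+w = ≰⇒> λ w≤k → <⇒≱ (clique-bound w (ν + ν) dense small) (begin
    4 * w               ≡⟨ quadruple w ⟩
    (w + w) + (w + w)   ≤⟨ +-mono-≤ (+-monoˡ-≤ w w≤k) (+-monoˡ-≤ w w≤k) ⟩
    (k + w) + (k + w)   ≡⟨ cong₂ _+_ k+w k+w ⟩
    suc ν + suc ν       ≡⟨ cong suc (+-suc ν ν) ⟩
    suc (suc (ν + ν))   ∎)
    where
    open ≤-Reasoning
    quadruple : ∀ w → 4 * w ≡ (w + w) + (w + w)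
    quadruple = solve-∀

  -- Reduction to the factor-critical case.

  -- had ≥ χ in terms of the complement: a matching of size r gives a colouring with |X| - r colours, and K
  -- together with the s seagulls gives a complete minor with |K| + s branch sets.
  record Good (X : List V) : Set where
    constructor good
    field
      {r s}    : ℕ
      {K Y}    : List V
      matching : Matching r X
      cover    : K ++ Y ↭ X
      free     : Independent K
      gulls    : Packing Seagull s Y
      enough   : length X ≤ length K + s + r

  -- The ratio is `33/124 = 1/4 + 1/62`.
  record Dense (X : List V) : Set where
    constructor dense-clique
    field
      {K Y}   : List V
      cover   : K ++ Y ↭ X
      free    : Independent K
      maximal : Maximal (length K) X
      dense   : 33 * length X ≤ 124 * length K

  matching-pred : ∀ {t xs} → Matching (suc t) xs → Matching t xs
  matching-pred (packing {b ∷ F} {r} F≡ (_ ∷ es) cov) =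
    packing {blocks = F} {b ++ r} (suc-injective F≡) es (trans (trans (shifts (concat F) b) (↭-sym (++-assoc b (concat F) r))) cov)

  matching-≤ : ∀ {s t xs} → s ≤ t → Matching t xs → Matching s xs
  matching-≤ {s} s≤t m with m≤n⇒∃[o]m+o≡n s≤t
  ... | o , ≡.refl = drop o m
    where
    drop : ∀ o {xs} → Matching (s + o) xs → Matching s xs
    drop zero m    = packing-count (+-identityʳ s) m
    drop (suc o) m = drop o (matching-pred (packing-count (+-suc s o) m))

  -- Removing a vertex destroys at most one edge of a matching.
  matching-drop : ∀ {k} K {Y} → Matching (length K + k) (K ++ Y) → Matching k Y
  matching-drop [] m = m
  matching-drop {k} (x ∷ K) {Y} m with mate-of m
  ... | inj₁ m′ = matching-drop K (matching-pred m′)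
  ... | inj₂ (matched {mate = y} ≡.refl _ p m′) = matching-drop K (packing-resp (↭-sym p) (packing-+ˡ [ y ] m′))

  factor-critical : ∀ {X ν} → Dense X → length X ≡ suc (ν + ν) → (∀ {v W} → X ↭ v ∷ W → Matching ν W) →
                    Matching ν X → Good X
  factor-critical {X} {ν} (dense-clique {K} {Y} cov free maximal dense) size avoiding M with suc ν ≤? length K
  ... | yes large = good {r = ν} {0} {K} {Y} M cov free packing-zero (begin
      length X                ≡⟨ size ⟩
      suc ν + ν               ≤⟨ +-monoˡ-≤ ν large ⟩
      length K + ν            ≡⟨ cong (_+ ν) (+-identityʳ (length K)) ⟨
      length K + 0 + ν        ∎)
    where open ≤-Reasoning
  factor-critical {X} {ν} (dense-clique {[]} cov free maximal dense) size avoiding M | no _ =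
    ⊥-elim (n≮0 (≤-trans (≤-reflexive (cong (33 *_) (≡.sym size))) dense))
  factor-critical {X} {ν} (dense-clique {K@(v ∷ K′)} {Y} cov free maximal dense) size avoiding M | no small =
    good {r = ν} {k} {K} {Y} M cov free
      (SeagullsIn.seagulls Y (length K) k join-bound no-pentagon size-Y k<w
        -- The matching already avoids `v` in `K`, so only the other `|K| - 1` vertices of `K` can
        -- cost an edge, and `k = ν + 1 - |K|` edges survive in `Y`.
        (matching-drop K′ (packing-count (≡.sym ν≡) (avoiding (↭-sym cov)))))
      (≤-reflexive (≡.trans size (cong (_+ ν) (≡.trans (≡.sym k+w) (+-comm k (length K))))))
    where
    open MaximumIndependent cov free maximal
    k = suc ν ∸ length K
    k+w : k + length K ≡ suc ν
    k+w = m∸n+n≡m (<⇒≤ (≰⇒> small))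
    ν≡ : length K′ + k ≡ ν
    ν≡ = suc-injective (≡.trans (+-comm (length K) k) k+w)
    size-Y : suc (length Y) ≡ k + k + length K
    size-Y = +-cancelˡ-≡ (length K) _ _ (begin
      length K + suc (length Y)          ≡⟨ +-suc (length K) (length Y) ⟩
      suc (length K + length Y)          ≡⟨ cong suc (≡.trans (≡.sym (length-++ K)) (≡.trans (↭-length cov) size)) ⟩
      suc (suc (ν + ν))                  ≡⟨ cong suc (+-suc ν ν) ⟨
      suc ν + suc ν                      ≡⟨ cong₂ _+_ k+w k+w ⟨
      (k + length K) + (k + length K)    ≡⟨ regroup k (length K) ⟩
      length K + (k + k + length K)      ∎)
      where
      open ≡.≡-Reasoning
      regroup : ∀ k w → (k + w) + (k + w) ≡ w + (k + k + w)
      regroup = solve-∀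
    k<w : k < length K
    k<w = packing-number-bound {ν = ν} (≤-trans (≤-reflexive (cong (33 *_) (≡.sym size))) dense)
      (≤-trans (≤-reflexive (cong (2 *_) (≡.sym size))) (ramsey (length K) X maximal)) k+w

  -- Every matching of `W` has fewer than `ν` edges, so passing to `M` gains at least the one edge
  -- that pays for `u`.
  good-extend : ∀ {X W u ν} → X ↭ u ∷ W → Matching ν X → ¬ Matching ν W → Good W → Good X
  good-extend {X} {W} {u} {ν} p M ¬M (good {r} {s} {K} {Y} m cov free gulls enough) = good {r = ν} {s} {K} {u ∷ Y} M
    (trans (shift u K Y) (trans (prep u cov) (↭-sym p))) free (packing-+ˡ [ u ] gulls) (begin
      length X                   ≡⟨ ↭-length p ⟩
      suc (length W)             ≤⟨ s≤s enough ⟩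
      suc (length K + s + r)     ≡⟨ +-suc (length K + s) r ⟨
      length K + s + suc r       ≤⟨ +-monoʳ-≤ (length K + s) (≰⇒> λ ν≤r → ¬M (matching-≤ ν≤r m)) ⟩
      length K + s + ν           ∎)
    where open ≤-Reasoning

  -- Without edges between the parts, the union of the two independent sets is independent, and all
  -- the counts add.
  good-join : ∀ {X L M} → L ++ M ↭ X → (∀ {u v} → u ∈ L → v ∈ M → ¬ E u v) → Good L → Good M → Good X
  good-join {X} {L} {M} p apart′ (good {r} {s} {K} {Y} m cov free gulls enough)
    (good {r′} {s′} {K′} {Y′} m′ cov′ free′ gulls′ enough′) =
    good {r = r + r′} {s + s′} {K ++ K′} {Y ++ Y′} (packing-resp p (packing-++ m m′))
      (trans (solve 4 (λ k k′ y y′ → (k ⊕ k′) ⊕ (y ⊕ y′) ⊜ (k ⊕ y) ⊕ (k′ ⊕ y′)) refl K K′ Y Y′) (trans (++⁺ cov cov′) p))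
      free″ (packing-++ gulls gulls′) (begin
        length X                                        ≡⟨ ↭-length p ⟨
        length (L ++ M)                                 ≡⟨ length-++ L ⟩
        length L + length M                             ≤⟨ +-mono-≤ enough enough′ ⟩
        (length K + s + r) + (length K′ + s′ + r′)      ≡⟨ regroup (length K) s r (length K′) s′ r′ ⟩
        (length K + length K′) + (s + s′) + (r + r′)    ≡⟨ cong (λ n → n + (s + s′) + (r + r′)) (length-++ K) ⟨
        length (K ++ K′) + (s + s′) + (r + r′)          ∎)
    where
    open ≤-Reasoning
    regroup : ∀ k s r k′ s′ r′ → (k + s + r) + (k′ + s′ + r′) ≡ (k + k′) + (s + s′) + (r + r′)
    regroup = solve-∀
    in-L : ∀ {v} → v ∈ K → v ∈ L
    in-L v = ∈-resp-↭ cov (∈-++⁺ˡ v)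
    in-M : ∀ {v} → v ∈ K′ → v ∈ M
    in-M v = ∈-resp-↭ cov′ (∈-++⁺ˡ v)
    free″ : Independent (K ++ K′)
    free″ u v with ∈-++⁻ K u | ∈-++⁻ K v
    ... | inj₁ u | inj₁ v = free u v
    ... | inj₁ u | inj₂ v = apart′ (in-L u) (in-M v)
    ... | inj₂ u | inj₁ v = non-edge (apart′ (in-L v) (in-M u))
    ... | inj₂ u | inj₂ v = free′ u v

  sort-by : ∀ {A B : V → Set} xs → (∀ {x} → x ∈ xs → A x ⊎ B x) →
            ∃₂ λ L M → L ++ M ↭ xs × (∀ {x} → x ∈ L → A x) × (∀ {x} → x ∈ M → B x)
  sort-by [] f = [] , [] , refl , (λ ()) , λ ()
  sort-by (x ∷ xs) f with f (here ≡.refl) | sort-by xs (λ x∈ → f (there x∈))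
  ... | inj₁ a | L , M , p , g , h = x ∷ L , M , prep x p , (λ { (here ≡.refl) → a ; (there x∈) → g x∈ }) , h
  ... | inj₂ b | L , M , p , g , h = L , x ∷ M , trans (shift x L M) (prep x p) , g , λ { (here ≡.refl) → b ; (there x∈) → h x∈ }

  Avoidable Unavoidable : ℕ → List V → V → Set
  Avoidable ν X v = ∀ {W} → X ↭ v ∷ W → Matching ν W
  Unavoidable ν X v = ∀ {W} → X ↭ v ∷ W → ¬ Matching ν W

  avoidable? : ∀ ν {X v} → v ∈ X → Avoidable ν X v ⊎ Unavoidable ν X v
  avoidable? ν v∈X with ∈-split v∈X
  ... | W , p with matching? ν W
  ...   | yes m = inj₁ λ q → packing-resp (drop-∷ (trans (↭-sym p) q)) m
  ...   | no ¬m = inj₂ λ q m → ¬m (packing-resp (drop-∷ (trans (↭-sym q) p)) m)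

  all-avoidable? : ∀ ν X → (∃ λ u → u ∈ X × Unavoidable ν X u) ⊎ (∀ {v} → v ∈ X → Avoidable ν X v)
  all-avoidable? ν X = all-or X check
    where
    check : ∀ {v} → v ∈ X → (∃ λ u → u ∈ X × Unavoidable ν X u) ⊎ Avoidable ν X v
    check v∈X with avoidable? ν v∈X
    ... | inj₁ av = inj₂ av
    ... | inj₂ un = inj₁ (_ , v∈X , un)

  -- Gallai: if every vertex is avoidable, then "no maximum matching avoids both" is an equivalence relation
  -- containing adjacency, so the class of x is a union of components.
  gallai : ∀ {x X ν c d} → (∀ {t} → Matching t (x ∷ X) → t ≤ ν) → (∀ {v} → v ∈ x ∷ X → Avoidable ν (x ∷ X) v) →
           c ∈ X → Unavoidable ν X c → d ∈ X → Avoidable ν X d → ¬ E c d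
  gallai {x} {X} {ν} {c} {d} maximal avoidable c∈X c-un d∈X d-av cd with ∈-split c∈X | ∈-split d∈X
  ... | Wc , pc | Wd , pd with exchange ν xd↭cx (d-av pd) (avoidable (there c∈X) (trans (prep x pc) (swap x c refl)))
    where
    xd↭cx : x ∷ d ∷ Wd ↭ c ∷ x ∷ Wc
    xd↭cx = trans (prep x (trans (↭-sym pd) pc)) (swap x c refl)
  -- The three outcomes are a larger matching, a maximum matching missing `x` and `c`, and one
  -- missing `c` and `d`, to which `cd` could be added.
  ...   | inj₁ m = 1+n≰n (maximal (packing-resp (prep x (↭-sym pd)) m))
  ...   | inj₂ (inj₁ (Z , q , m)) = c-un pc (packing-resp (↭-sym (drop-∷ q)) m)
  ...   | inj₂ (inj₂ (Z , q , m)) = 1+n≰n (maximal (matching-∷ cd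
            (trans (prep c (↭-sym q)) (trans (swap c x refl) (prep x (↭-sym pc)))) m))

  -- A vertex left over by the matching would be avoidable, so the matching is perfect.
  all-unavoidable : ∀ {X ν} → Matching ν X → (∀ {v} → v ∈ X → Unavoidable ν X v) → length X ≡ ν + ν
  all-unavoidable {X} {ν} (packing {F} {[]} F≡ es cov) un = begin
    length X                     ≡⟨ ↭-length cov ⟨
    length (concat F ++ [])      ≡⟨ length-++ (concat F) ⟩
    length (concat F) + 0        ≡⟨ +-identityʳ _ ⟩
    length (concat F)            ≡⟨ length-edges es ⟩
    length F * 2                 ≡⟨ cong (_* 2) F≡ ⟩
    ν * 2                        ≡⟨ *-comm ν 2 ⟩
    ν + (ν + 0)                  ≡⟨ cong (ν +_) (+-identityʳ ν) ⟩
    ν + ν                        ∎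
    where open ≡.≡-Reasoning
  all-unavoidable (packing {F} {v ∷ r} F≡ es cov) un =
    ⊥-elim (un (∈-resp-↭ cov (∈-++⁺ʳ (concat F) (here ≡.refl))) (trans (↭-sym cov) (shift v (concat F) r)) (packing F≡ es refl))

  module _ (dense : ∀ X → Dense X) where

    good-sized : ∀ n X → length X ≤ n → Good X
    good-sized n [] _ = good {r = 0} {0} {[]} {[]} packing-zero refl (λ ()) packing-zero z≤n
    good-sized (suc n) (x ∷ X) (s≤s le)
      with maximum (λ t → matching? t (x ∷ X)) packing-zero (length (x ∷ X)) matching-size
    ... | ν , M , maximal with all-avoidable? ν (x ∷ X)
    ...   | inj₁ (u , u∈ , un) = extend (∈-split u∈)
      where
      extend : (∃ λ W → x ∷ X ↭ u ∷ W) → Good (x ∷ X)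
      extend (W , p) = good-extend p M (un p) (good-sized n W (≤-trans (≤-reflexive (suc-injective (≡.sym (↭-length p)))) le))
    ...   | inj₂ avoidable with sort-by X (avoidable? ν)
    -- The class of `x` is everything: a matching of size `ν` avoiding `x` covers all of `X`, so
    -- there are `2 ν + 1` vertices.
    ...     | [] , C , C↭ , _ , un = factor-critical (dense (x ∷ X)) (cong suc
      (all-unavoidable (avoidable (here ≡.refl) refl) (λ v → un (∈-resp-↭ (↭-sym C↭) v))))
      (λ p → avoidable (∈-resp-↭ (↭-sym p) (here ≡.refl)) p) M
    -- The class `x ∷ C` and its non-empty complement `D` are both smaller, and no edge runs between
    -- them.
    ...     | D@(d ∷ D′) , C , DC , av , un = good-join {L = x ∷ C} {D} (prep x (trans (++-comm C D) DC)) separated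
      (good-sized n (x ∷ C) (≤-trans (≤-trans (s≤s (m≤n+m (length C) (length D′)))
        (≤-reflexive (≡.trans (≡.sym (length-++ D)) (↭-length DC)))) le))
      (good-sized n D (≤-trans (≤-trans (m≤m+n (length D) (length C))
        (≤-reflexive (≡.trans (≡.sym (length-++ D)) (↭-length DC)))) le))
      where
      in-X : ∀ {v} → v ∈ D → v ∈ X
      in-X v = ∈-resp-↭ DC (∈-++⁺ˡ v)
      separated : ∀ {u v} → u ∈ x ∷ C → v ∈ D → ¬ E u v
      separated (there u) v = gallai maximal avoidable (∈-resp-↭ DC (∈-++⁺ʳ D u)) (un u) (in-X v) (av v)
      separated (here ≡.refl) v uv with ∈-split (in-X v)
      ... | W , p = 1+n≰n (maximal (matching-∷ uv (prep x (↭-sym p)) (av v p)))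

    good-all : ∀ X → Good X
    good-all X = good-sized (length X) X ≤-refl

-- Lists without repetition.

module _ {X : Set} where

  unique-resp : {xs ys : List X} → xs ↭ ys → Unique xs → Unique ys
  unique-resp p = SetoidPermutation.Unique-resp-↭ (≡.setoid X) (↭⇒↭ₛ p)

  unique-++ˡ : ∀ (xs : List X) {ys} → Unique (xs ++ ys) → Unique xs
  unique-++ˡ []       _        = []
  unique-++ˡ (x ∷ xs) (x∉ ∷ u) = All.++⁻ˡ xs x∉ ∷ unique-++ˡ xs u

  unique-++-disjoint : ∀ (xs : List X) {ys v} → Unique (xs ++ ys) → v ∈ xs → v ∈ ys → ⊥
  unique-++-disjoint (x ∷ xs) (x∉ ∷ u) (here ≡.refl) v∈ys = All.lookup x∉ (∈-++⁺ʳ xs v∈ys) ≡.refl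
  unique-++-disjoint (x ∷ xs) (_ ∷ u)  (there v∈xs)  v∈ys = unique-++-disjoint xs u v∈xs v∈ys

  unique-lookup : ∀ {xs : List X} → Unique xs → ∀ {i j} → lookup xs i ≡ lookup xs j → i ≡ j
  unique-lookup (_ ∷ _)  {Fin.zero}  {Fin.zero}  _  = ≡.refl
  unique-lookup (x∉ ∷ _) {Fin.zero}  {Fin.suc j} eq = ⊥-elim (All.lookup x∉ (∈-lookup j) eq)
  unique-lookup (x∉ ∷ _) {Fin.suc i} {Fin.zero}  eq = ⊥-elim (All.lookup x∉ (∈-lookup i) (≡.sym eq))
  unique-lookup (_ ∷ u)  {Fin.suc i} {Fin.suc j} eq = cong Fin.suc (unique-lookup u eq)

  unique-complement : ∀ {xs ys : List X} → Unique xs → (∀ {x} → x ∈ xs → x ∈ ys) → ∃ λ r → xs ++ r ↭ ys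
  unique-complement {[]} {ys} [] _ = ys , refl
  unique-complement {x ∷ xs} {ys} (x∉ ∷ u) sub with ∈-∃++ (sub (here ≡.refl))
  ... | ys₁ , ys₂ , ≡.refl with unique-complement u sub′
    where
    sub′ : ∀ {z} → z ∈ xs → z ∈ ys₁ ++ ys₂
    sub′ z∈ with ∈-resp-↭ (shift x ys₁ ys₂) (sub (there z∈))
    ... | here z≡x = ⊥-elim (All.lookup x∉ z∈ (≡.sym z≡x))
    ... | there z∈′ = z∈′
  ... | r , p = r , trans (prep x p) (↭-sym (shift x ys₁ ys₂))

  class-unique : ∀ (bs : List (List X)) {v} → Unique (concat bs) → ∀ {i j} →
                 v ∈ lookup bs i → v ∈ lookup bs j → i ≡ j
  class-unique (b ∷ bs) u {Fin.zero}  {Fin.zero}  _ _ = ≡.refl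
  class-unique (b ∷ bs) u {Fin.zero}  {Fin.suc j} p q = ⊥-elim (unique-++-disjoint b u p (∈-concat⁺′ q (∈-lookup {xs = bs} j)))
  class-unique (b ∷ bs) u {Fin.suc i} {Fin.zero}  p q = ⊥-elim (unique-++-disjoint b u q (∈-concat⁺′ p (∈-lookup {xs = bs} i)))
  class-unique (b ∷ bs) u {Fin.suc i} {Fin.suc j} p q = cong Fin.suc (class-unique bs (unique-++ʳ b u) p q)
    where
    unique-++ʳ : ∀ xs {ys : List X} → Unique (xs ++ ys) → Unique ys
    unique-++ʳ []       u       = u
    unique-++ʳ (_ ∷ xs) (_ ∷ u) = unique-++ʳ xs u

  map-split : ∀ {Y : Set} (f : Y → X) ys {xs xs′} → map f ys ≡ xs ++ xs′ →
              ∃₂ λ ys₁ ys₂ → ys ≡ ys₁ ++ ys₂ × map f ys₁ ≡ xs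
  map-split f ys {[]} _ = [] , ys , ≡.refl , ≡.refl
  map-split f (y ∷ ys) {x ∷ xs} eq with ∷-injective eq
  ... | ≡.refl , eq′ with map-split f ys {xs} eq′
  ...   | ys₁ , ys₂ , ≡.refl , ≡.refl = y ∷ ys₁ , ys₂ , ≡.refl , ≡.refl

map-lookup : ∀ {X : Set} (xs : List X) → map (lookup xs) (allFin (length xs)) ≡ xs
map-lookup xs = ≡.trans (map-tabulate (λ i → i) (lookup xs)) (tabulate-lookup xs)

walk-map : ∀ {m} {G : Graph m} {P Q : Fin m → Set} → (∀ {x} → P x → Q x) → ∀ {u v} → WalkIn G P u v → WalkIn G Q u v
walk-map f (here p)     = here (f p)
walk-map f (step p a w) = step (f p) a (walk-map f w)

-- The complement of a graph and its inflations by lists.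

module InducedInflation {m} (G : Graph m) (at-most-two : ∀ k → HasIndependentSet G k → k ≤ 2) where

  E : Fin m → Fin m → Set
  E u v = u ≢ v × ¬ Adj G u v

  E? : ∀ u v → Dec (E u v)
  E? u v = ¬? (u ≟ᶠ v) ×-dec ¬? (dec G u v)

  E-sym : ∀ {u v} → E u v → E v u
  E-sym (u≢v , ¬uv) = (λ v≡u → u≢v (≡.sym v≡u)) , λ vu → ¬uv (sym G vu)

  adjacent : ∀ {u v} → u ≢ v → ¬ E u v → Adj G u v
  adjacent {u} {v} u≢v ¬e = decidable-stable (dec G u v) λ ¬uv → ¬e (u≢v , ¬uv)

  E-tri : ∀ {a b c} → E a b → E b c → E a c → ⊥
  E-tri {a} {b} {c} (a≢b , ¬ab) (b≢c , ¬bc) (a≢c , ¬ac) = 1+n≰n (at-most-two 3 (lookup abc , unique-lookup unique , free))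
    where
    abc = a ∷ b ∷ c ∷ []
    unique : Unique abc
    unique = (a≢b ∷ a≢c ∷ []) ∷ (b≢c ∷ []) ∷ [] ∷ []
    free : ∀ i j → ¬ Adj G (lookup abc i) (lookup abc j)
    free Fin.zero Fin.zero = irrefl G
    free Fin.zero (Fin.suc Fin.zero) = ¬ab
    free Fin.zero (Fin.suc (Fin.suc Fin.zero)) = ¬ac
    free (Fin.suc Fin.zero) Fin.zero e = ¬ab (sym G e)
    free (Fin.suc Fin.zero) (Fin.suc Fin.zero) = irrefl G
    free (Fin.suc Fin.zero) (Fin.suc (Fin.suc Fin.zero)) = ¬bc
    free (Fin.suc (Fin.suc Fin.zero)) Fin.zero e = ¬ac (sym G e)
    free (Fin.suc (Fin.suc Fin.zero)) (Fin.suc Fin.zero) e = ¬bc (sym G e)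
    free (Fin.suc (Fin.suc Fin.zero)) (Fin.suc (Fin.suc Fin.zero)) = irrefl G

  open Packing-seagulls E E? E-sym E-tri

  -- The vertices are positions in `X`. Distinct positions holding the same vertex are adjacent, as
  -- `E` is irreflexive, so repetitions become twins.
  inflate : (X : List (Fin m)) → Graph (length X)
  inflate X = record
    { Adj = λ i j → i ≢ j × ¬ E (lookup X i) (lookup X j)
    ; sym = λ (i≢j , ¬e) → (λ j≡i → i≢j (≡.sym j≡i)) , λ e → ¬e (E-sym e)
    ; irrefl = λ (i≢i , _) → i≢i ≡.refl
    ; dec = λ i j → ¬? (i ≟ᶠ j) ×-dec ¬? (E? (lookup X i) (lookup X j))
    }

  inflate-inflation : ∀ {n} {G₀ : Graph n} → IsInflationOf G G₀ → ∀ X → IsInflationOf (inflate X) G₀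
  inflate-inflation {G₀ = G₀} (f , inf) X = (λ i → f (lookup X i)) , λ i j i≢j → to i j , λ fe → i≢j , from i j fe
    where
    to : ∀ i j → Adj (inflate X) i j → f (lookup X i) ≡ f (lookup X j) ⊎ Adj G₀ (f (lookup X i)) (f (lookup X j))
    to i j (_ , ¬e) with lookup X i ≟ᶠ lookup X j
    ... | yes eq = inj₁ (cong f eq)
    ... | no ne  = proj₁ (inf _ _ ne) (adjacent ne ¬e)
    from : ∀ i j → f (lookup X i) ≡ f (lookup X j) ⊎ Adj G₀ (f (lookup X i)) (f (lookup X j)) → ¬ E (lookup X i) (lookup X j)
    from i j fe (ne , ¬adj) = ¬adj (proj₂ (inf _ _ ne) fe)

  independent⇒clique : ∀ {k} X → IndependentIn k X → HasClique (inflate X) k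
  independent⇒clique X (independent {K} {r} ≡.refl cov free)
    -- A clique consists of positions rather than vertices, so the permutation is lifted along
    -- `lookup X`.
    with ↭-map-inv (lookup X) {allFin (length X)} (trans (↭-reflexive (map-lookup X)) (↭-sym cov))
  ... | ys , eq , p with map-split (lookup X) ys {K} (≡.sym eq)
  ...   | I , J , ≡.refl , ≡.refl = subst (HasClique (inflate X)) (≡.sym (length-map (lookup X) I))
    (lookup I , unique-lookup unique , λ i j i≢j → (λ eq → i≢j (unique-lookup unique eq)) ,
      free (∈-map⁺ (lookup X) (∈-lookup i)) (∈-map⁺ (lookup X) (∈-lookup j)))
    where
    unique : Unique I
    unique = unique-++ˡ I (unique-resp p (allFin⁺ _))

  clique⇒independent : ∀ {k} X → HasClique (inflate X) k → IndependentIn k X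
  clique⇒independent X (s , inj , clique) with unique-complement {ys = allFin (length X)} (tabulate⁺ inj) (λ _ → ∈-allFin _)
  ... | r , p = independent {chosen = map (lookup X) (tabulate s)} {map (lookup X) r}
    (≡.trans (length-map (lookup X) (tabulate s)) (length-tabulate s))
    (trans (↭-reflexive (≡.sym (map-++ (lookup X) (tabulate s) r))) (trans (map⁺ (lookup X) p) (↭-reflexive (map-lookup X))))
    free
    where
    free : Independent (map (lookup X) (tabulate s))
    free u∈ v∈ with ∈-map⁻ (lookup X) u∈ | ∈-map⁻ (lookup X) v∈
    ... | i′ , i∈ , ≡.refl | j′ , j∈ , ≡.refl with ∈-tabulate⁻ i∈ | ∈-tabulate⁻ j∈
    ...   | i , ≡.refl | j , ≡.refl with i ≟ᶠ j
    ...     | yes ≡.refl = E-irrefl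
    ...     | no i≢j = proj₂ (clique i j i≢j)

  dense-all : (∀ X → 0 < length X → ∀ w → IsCliqueNumber (inflate X) w → 33 * length X ≤ 124 * w) → ∀ X → Dense X
  dense-all ratio X with maximum (λ k → independent? k X) (independent {chosen = []} ≡.refl refl λ ()) (length X) independent-size
  dense-all ratio [] | _ , independent {K} {r} ≡.refl cov free , maximal = dense-clique cov free maximal z≤n
  dense-all ratio X@(_ ∷ _) | _ , independent {K} {r} ≡.refl cov free , maximal = dense-clique cov free maximal
    (ratio X (s≤s z≤n) (length K) (independent⇒clique X (independent ≡.refl cov free) , λ k c → maximal (clique⇒independent X c)))

  -- Colourings from matchings and clique minors from seagulls.

  Member : List (List (Fin m)) → Fin m → Set
  Member bs v = Any (v ∈_) bs

  member? : ∀ bs v → Dec (Member bs v)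
  member? bs v = any? (λ b → any? (v ≟ᶠ_) b) bs

  colourable : ∀ bs → (∀ v → Member bs v) → All (λ b → ∀ {u v} → u ∈ b → v ∈ b → ¬ Adj G u v) bs →
               Colourable G (length bs)
  colourable bs member free = (λ v → Any.index (member v)) , λ u v uv eq →
    All.lookup free (∈-lookup {xs = bs} (Any.index (member u))) (Any.lookup-index (member u))
      (subst (λ i → v ∈ lookup bs i) (≡.sym eq) (Any.lookup-index (member v))) uv

  edge-free : ∀ {b} → Edge b → ∀ {u v} → u ∈ b → v ∈ b → ¬ Adj G u v
  edge-free (edge _) (here ≡.refl) (here ≡.refl) = irrefl G
  edge-free (edge (_ , ¬ab)) (here ≡.refl) (there (here ≡.refl)) = ¬ab
  edge-free (edge (_ , ¬ab)) (there (here ≡.refl)) (here ≡.refl) ba = ¬ab (sym G ba)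
  edge-free (edge _) (there (here ≡.refl)) (there (here ≡.refl)) = irrefl G

  concat-singletons : ∀ (xs : List (Fin m)) → concat (map [_] xs) ≡ xs
  concat-singletons []       = ≡.refl
  concat-singletons (x ∷ xs) = cong (x ∷_) (concat-singletons xs)

  matching-colouring : ∀ {r} → Matching r (allFin m) → ∃ λ c → Colourable G c × c + r ≡ m
  matching-colouring {r} (packing {F} {rest} F≡ es cov) = length classes , colourable classes member
    (All.++⁺ (All.map edge-free es) (All.map⁺ (All.universal (λ _ → λ { (here ≡.refl) (here ≡.refl) → irrefl G }) rest))) ,
    count
    where
    classes = F ++ map [_] rest
    member : ∀ v → Member classes v
    member v with ∈-++⁻ (concat F) (∈-resp-↭ (↭-sym cov) (∈-allFin v))
    ... | inj₁ v∈ with ∈-concat⁻′ F v∈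
    ...   | f , v∈f , f∈F = lose (∈-++⁺ˡ f∈F) v∈f
    member v | inj₂ v∈ = lose (∈-++⁺ʳ F (∈-map⁺ [_] v∈)) (here ≡.refl)
    count : length classes + r ≡ m
    count = begin
      length (F ++ map [_] rest) + r           ≡⟨ cong₂ _+_ (length-++ F) (≡.sym F≡) ⟩
      length F + length (map [_] rest) + length F ≡⟨ cong (λ n → length F + n + length F) (length-map [_] rest) ⟩
      length F + length rest + length F        ≡⟨ regroup (length F) (length rest) ⟩
      length F * 2 + length rest               ≡⟨ cong (_+ length rest) (length-edges es) ⟨
      length (concat F) + length rest          ≡⟨ length-++ (concat F) ⟨
      length (concat F ++ rest)                ≡⟨ ↭-length cov ⟩
      length (allFin m)                        ≡⟨ length-tabulate (λ i → i) ⟩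
      m                                        ∎
      where
      open ≡.≡-Reasoning
      regroup : ∀ f r → f + r + f ≡ f * 2 + r
      regroup = solve-∀

  data Bag (K : List (Fin m)) : List (Fin m) → Set where
    single : ∀ {x} → x ∈ K → Bag K [ x ]
    gull   : ∀ {b} → Seagull b → Bag K b

  bag-inhabited : ∀ {K b} → Bag K b → ∃ (_∈ b)
  bag-inhabited (single _) = _ , here ≡.refl
  bag-inhabited (gull (seagull _ _ _)) = _ , here ≡.refl

  -- In the graph itself `c` is the middle of the induced path, so walks are routed through `c`.
  bag-connected : ∀ {K b} → Bag K b → ∀ {u v} → u ∈ b → v ∈ b → WalkIn G (_∈ b) u v
  bag-connected (single _) (here ≡.refl) (here ≡.refl) = here (here ≡.refl)
  bag-connected (gull (seagull {a} {b} {c} ab ¬ac ¬bc)) u v = join (to-c u) v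
    where
    Walk = WalkIn G (_∈ a ∷ b ∷ c ∷ [])
    a∈ : a ∈ a ∷ b ∷ c ∷ []
    a∈ = here ≡.refl
    b∈ : b ∈ a ∷ b ∷ c ∷ []
    b∈ = there (here ≡.refl)
    c∈ : c ∈ a ∷ b ∷ c ∷ []
    c∈ = there (there (here ≡.refl))
    ac : Adj G a c
    ac = adjacent (λ { ≡.refl → ¬bc (E-sym ab) }) ¬ac
    bc : Adj G b c
    bc = adjacent (λ { ≡.refl → ¬ac ab }) ¬bc
    to-c : ∀ {u} → u ∈ a ∷ b ∷ c ∷ [] → Walk u c
    to-c (here ≡.refl)                 = step a∈ ac (here c∈)
    to-c (there (here ≡.refl))         = step b∈ bc (here c∈)
    to-c (there (there (here ≡.refl))) = here c∈
    append : ∀ {u v} → Walk u c → Adj G c v → v ∈ a ∷ b ∷ c ∷ [] → Walk u v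
    append (here _)     cv v∈ = step c∈ cv (here v∈)
    append (step p e w) cv v∈ = step p e (append w cv v∈)
    join : ∀ {u v} → Walk u c → v ∈ a ∷ b ∷ c ∷ [] → Walk u v
    join w (here ≡.refl)                 = append w (sym G ac) a∈
    join w (there (here ≡.refl))         = append w (sym G bc) b∈
    join w (there (there (here ≡.refl))) = w

  Disjoint : List (Fin m) → List (Fin m) → Set
  Disjoint b b′ = ∀ {v} → v ∈ b → v ∈ b′ → ⊥

  Touching : List (Fin m) → List (Fin m) → Set
  Touching b b′ = ∃₂ λ u v → u ∈ b × v ∈ b′ × Adj G u v

  -- A seagull contains two vertices that are joined in the complement, so no third vertex misses both.
  seagull-touches : ∀ {b z b′} → Seagull b → z ∈ b′ → Disjoint b b′ → Touching b b′
  seagull-touches {z = z} (seagull {a} {b} ab _ _) z∈ disjoint with E? a z | E? b z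
  ... | no ¬az | _ = a , z , here ≡.refl , z∈ , adjacent (λ { ≡.refl → disjoint (here ≡.refl) z∈ }) ¬az
  ... | yes _ | no ¬bz = b , z , there (here ≡.refl) , z∈ , adjacent (λ { ≡.refl → disjoint (there (here ≡.refl)) z∈ }) ¬bz
  ... | yes az | yes bz = ⊥-elim (E-tri ab bz az)

  touching-sym : ∀ {b b′} → Touching b b′ → Touching b′ b
  touching-sym (u , v , u∈ , v∈ , uv) = v , u , v∈ , u∈ , sym G uv

  bags-touch : ∀ {K b b′} → Independent K → Bag K b → Bag K b′ → Disjoint b b′ → Touching b b′
  bags-touch free (gull s) bag disjoint = seagull-touches s (proj₂ (bag-inhabited bag)) disjoint
  bags-touch free (single x∈) (gull s) disjoint = touching-sym (seagull-touches s (here ≡.refl) λ v w → disjoint w v)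
  bags-touch free (single {x} x∈) (single {y} y∈) disjoint =
    x , y , here ≡.refl , here ≡.refl , adjacent (λ { ≡.refl → disjoint (here ≡.refl) (here ≡.refl) }) (free x∈ y∈)

  clique-minor : ∀ {K} bs → Independent K → All (Bag K) bs → Unique (concat bs) → HasCliqueMinor G (length bs)
  clique-minor {K} bs free bags unique = β , inhabited , connected , touching
    where
    index-of : ∀ {v} → Dec (Member bs v) → Maybe (Fin (length bs))
    index-of (yes p) = just (Any.index p)
    index-of (no _)  = nothing
    β : Fin m → Maybe (Fin (length bs))
    β v = index-of (member? bs v)
    bag : ∀ i → Bag K (lookup bs i)
    bag i = All.lookup bags (∈-lookup {xs = bs} i)
    β-sound : ∀ {i} v → β v ≡ just i → v ∈ lookup bs i
    β-sound v eq with member? bs v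
    β-sound v ≡.refl | yes p = Any.lookup-index p
    β-complete : ∀ {i v} → v ∈ lookup bs i → β v ≡ just i
    β-complete {i} {v} v∈ with member? bs v
    -- The bags are disjoint, so the index found by the search is `i`.
    ... | yes p = cong just (class-unique bs unique (Any.lookup-index p) v∈)
    ... | no ¬p = ⊥-elim (¬p (lose (∈-lookup {xs = bs} i) v∈))
    inhabited : ∀ i → ∃ λ u → β u ≡ just i
    inhabited i with bag-inhabited (bag i)
    ... | u , u∈ = u , β-complete u∈
    connected : ∀ i u v → β u ≡ just i → β v ≡ just i → WalkIn G (λ x → β x ≡ just i) u v
    connected i u v βu βv = walk-map β-complete (bag-connected (bag i) (β-sound u βu) (β-sound v βv))
    touching : ∀ i j → i ≢ j → Σ (Fin m) λ u → Σ (Fin m) λ v → β u ≡ just i × β v ≡ just j × Adj G u v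
    touching i j i≢j with bags-touch free (bag i) (bag j) (λ p q → i≢j (class-unique bs unique p q))
    ... | u , v , u∈ , v∈ , uv = u , v , β-complete u∈ , β-complete v∈ , uv

  good-minor : ∀ {s K Y} → K ++ Y ↭ allFin m → Independent K → Packing Seagull s Y → HasCliqueMinor G (length K + s)
  good-minor {s} {K} {Y} cov free (packing {Q} {rest} Q≡ ss cov′) = subst (HasCliqueMinor G) count
    (clique-minor (map [_] K ++ Q) free (All.++⁺ (All.map⁺ (All.tabulate single)) (All.map gull ss))
      (unique-++ˡ (concat (map [_] K ++ Q)) (unique-resp (↭-sym cover) (allFin⁺ m))))
    where
    count : length (map [_] K ++ Q) ≡ length K + s
    count = ≡.trans (length-++ (map [_] K)) (cong₂ _+_ (length-map [_] K) Q≡)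
    cover : concat (map [_] K ++ Q) ++ rest ↭ allFin m
    cover = trans (trans (↭-reflexive (cong (_++ rest)
        (≡.trans (≡.sym (concat-++ (map [_] K) Q)) (cong (_++ concat Q) (concat-singletons K)))))
      (trans (++-assoc K (concat Q) rest) (++⁺ˡ K cov′))) cov

  good-bound : Good (allFin m) → ∀ {h k} → IsHadwigerNumber G h → IsChromaticNumber G k → k ≤ h
  good-bound (good {r} {s} {K} matching cover free gulls enough) {h} {k} (_ , had-max) (_ , chi-min)
    with matching-colouring matching
  ... | c , colouring , c+r = begin
    k                ≤⟨ chi-min c colouring ⟩
    c                ≤⟨ +-cancelʳ-≤ r c _ (≤-trans (≤-reflexive (≡.trans c+r (≡.sym (length-tabulate (λ i → i))))) enough) ⟩
    length K + s     ≤⟨ had-max _ (good-minor cover free gulls) ⟩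
    h                ∎
    where open ≤-Reasoning

theorem2p29 : ∀ {n} (G : Graph n) →
    IsIndependenceNumber G 2 →
    (∀ {m} (H : Graph m) → IsInflationOf H G → 0 < m →
    ∀ w → IsCliqueNumber H w → 33 * m ≤ 124 * w) →
    ∀ {m} (G' : Graph m) → IsInflationOf G' G → IsIndependenceNumber G' 2 →
    ∀ h k → IsHadwigerNumber G' h → IsChromaticNumber G' k → k ≤ h
theorem2p29 G _ ratio {m} G' inflation (_ , at-most-two) h k had chi =
  -- Inflating the inflation `G'` again gives an inflation of `G`, so the ratio hypothesis reaches
  -- every list of vertices of `G'`.
  good-bound (good-all (dense-all λ X pos → ratio (inflate X) (inflate-inflation {G₀ = G} inflation X) pos) (allFin m)) had chi
  where
  open InducedInflation G' at-most-two
  open Packing-seagulls E E? E-sym E-tri
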